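{- (a) Let $G$ be a balanced rectangular fabric graph built from strands $S_1,\dots,S_m$, and let $A_i$ be the bi-adjacency matrix of $S_i$ ($i=1,\dots,m$). Then $$\mathrm{M}(G)=\det(A_1A_2\cdots A_m).$$ (b) Let $G$ be a cylindrical fabric graph built from strands $S_1,\dots,S_m$, where $S_i$ has $l_{i-1}$ bottom vertices and $l_i$ top vertices ($i=1,\dots,m$, with $l_0:=l_m$), the vertical edges joining $S_i$ to $S_{i+1}$ having weight $x_i$ ($S_{m+1}:=S_1$), and let $A_i$ be the bi-adjacency matrix of $S_i$. Then $$\mathrm{M}(G;x_1,\dots,x_m)=x_1^{l_1-l_m}\cdots x_{m-1}^{l_{m-1}-l_m}\det\big((x_1\cdots x_m)I+A_1A_2\cdots A_m\big),$$ where $I$ is the identity matrix of order $l_m$.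
   Context: A strand is a weighted bipartite graph which is a path with pendant edges attached, drawn in the plane without edge crossings so that its white vertices $u_1,\dots,u_k$ lie from left to right on a horizontal line (the bottom vertices) and its black vertices $v_1,\dots,v_l$ lie from left to right on a parallel horizontal line above it (the top vertices), every edge being a straight segment joining a bottom vertex to a top vertex. Edge weights are arbitrary (possibly zero). The bi-adjacency matrix of a strand is the $k\times l$ matrix whose $(p,q)$ entry is the weight of the edge $\{u_p,v_q\}$ if it exists and $0$ otherwise. A rectangular fabric graph: take strands $S_1,\dots,S_m$, $S_i$ having $k_i$ bottom and $l_i$ top vertices, with $l_i=k_{i+1}$ for $i=1,\dots,m-1$; draw them one above the other with $S_1$ at the bottom, and join the $j$-th top vertex of $S_i$ to the $j$-th bottom vertex of $S_{i+1}$ by a (vertical) edge of weight $1$, for all $j$ and $i=1,\dots,m-1$. It is balanced if $k_1=l_m$ (equal numbers of white and black vertices). A cylindrical fabric graph: take strands $S_1,\dots,S_m$ with $l_i=k_{i+1}$ for $i=1,\dots,m$ where $k_{m+1}:=k_1$; join the $j$-th top vertex of $S_i$ to the $j$-th bottom vertex of $S_{i+1}$ for $i=1,\dots,m$ (with $S_{m+1}:=S_1$), these vertical edges between $S_i$ and $S_{i+1}$ all having weight $x_i$. For a weighted graph $G$, $\mathrm{M}(G)$ denotes the sum over all perfect matchings of $G$ of the product of the weights of the edges in the matching; for a cylindrical fabric graph this is written $\mathrm{M}(G;x_1,\dots,x_m)$ and regarded as a function of the vertical weights $x_i$. -}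

module Defs where

open import Level using (Level; _⊔_; 0ℓ) renaming (suc to lsuc)
open import Algebra.Bundles using (CommutativeRing)
open import Data.Bool.Base using (Bool; true; false; if_then_else_; T; _∧_)
open import Data.Bool.ListAction using (and)
open import Data.Nat.Base using (ℕ; zero; suc; _≡ᵇ_)
open import Data.Fin.Base using (Fin; zero; suc; punchIn) renaming (_<_ to _<ᶠ_)
open import Data.Fin.Properties using () renaming (_≟_ to _≟ᶠ_)
open import Data.List.Base using (List; []; _∷_; _++_; map; concatMap; filter; length; allFin; foldr)
open import Data.List.Membership.Propositional using (_∈_; _∉_)
open import Data.List.Relation.Unary.Unique.Propositional using (Unique)
open import Data.List.Relation.Unary.Linked using (Linked)
open import Data.Sum.Base using (_⊎_; inj₁; inj₂)
open import Data.Sum.Properties using (≡-dec)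
open import Data.Product.Base using (Σ; _×_; _,_; proj₁; proj₂; ∃₂)
open import Data.Empty using (⊥)
open import Relation.Nullary using (¬_)
open import Relation.Binary.Definitions using (DecidableEquality)
open import Relation.Binary.PropositionalEquality using (_≡_; _≢_)

-- Strand skeletons (purely combinatorial part of a strand).
-- Bottom (white) vertices u_1..u_k are  inj₁ p , p : Fin k  (left to right),
-- top (black) vertices v_1..v_l are    inj₂ q , q : Fin l  (left to right).

SVertex : ℕ → ℕ → Set
SVertex k l = Fin k ⊎ Fin l

Adj : ∀ {k l} → (Fin k → Fin l → Bool) → SVertex k l → SVertex k l → Set
Adj e (inj₁ p) (inj₂ q) = T (e p q)
Adj e (inj₂ q) (inj₁ p) = T (e p q)
Adj e (inj₁ _) (inj₁ _) = ⊥
Adj e (inj₂ _) (inj₂ _) = ⊥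

Consecutive : ∀ {A : Set} → A → A → List A → Set
Consecutive u v P =
  ∃₂ λ xs ys → (P ≡ xs ++ u ∷ v ∷ ys) ⊎ (P ≡ xs ++ v ∷ u ∷ ys)

record IsCaterpillar {k l : ℕ} (e : Fin k → Fin l → Bool) : Set where
  field
    spine          : List (SVertex k l)
    spine-nonempty : spine ≢ []
    spine-distinct : Unique spine
    spine-path     : Linked (Adj e) spine
    spine-induced  : ∀ u v → u ∈ spine → v ∈ spine → Adj e u v → Consecutive u v spine
    pendant        : ∀ v → v ∉ spine →
                     Σ (SVertex k l) λ u → u ∈ spine × Adj e v u × (∀ w → Adj e v w → w ≡ u)

-- straight segments u_p v_q and u_p' v_q' (vertices ordered left to right
-- on two parallel lines) do not cross
NonCrossing : ∀ {k l} → (Fin k → Fin l → Bool) → Set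
NonCrossing {k} {l} e = ∀ {p p' : Fin k} {q q' : Fin l} →
  T (e p q) → T (e p' q') → ¬ ((p <ᶠ p') × (q' <ᶠ q))

module _ {c ℓ : Level} (R : CommutativeRing c ℓ) where
  open CommutativeRing R using (Carrier; _+_; _*_; -_; 0#; 1#)

  sumL : List Carrier → Carrier
  sumL = foldr _+_ 0#

  prodL : List Carrier → Carrier
  prodL = foldr _*_ 1#

  sumFin : ∀ n → (Fin n → Carrier) → Carrier
  sumFin zero    f = 0#
  sumFin (suc n) f = f zero + sumFin n (λ i → f (suc i))

  prodFin : ∀ n → (Fin n → Carrier) → Carrier
  prodFin zero    f = 1#
  prodFin (suc n) f = f zero * prodFin n (λ i → f (suc i))

  pow : Carrier → ℕ → Carrier
  pow x zero    = 1#
  pow x (suc n) = x * pow x n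

  Matrix : ℕ → ℕ → Set c
  Matrix a b = Fin a → Fin b → Carrier

  _⊗_ : ∀ {a b d} → Matrix a b → Matrix b d → Matrix a d
  _⊗_ {b = b} A B i j = sumFin b (λ t → A i t * B t j)

  _⊕_ : ∀ {a b} → Matrix a b → Matrix a b → Matrix a b
  (A ⊕ B) i j = A i j + B i j

  _·ₘ_ : ∀ {a b} → Carrier → Matrix a b → Matrix a b
  (x ·ₘ A) i j = x * A i j

  identity : ∀ n → Matrix n n
  identity n i j with i ≟ᶠ j
  ... | Relation.Nullary.yes _ = 1#
  ... | Relation.Nullary.no  _ = 0#

  altSign : ∀ {n} → Fin n → Carrier
  altSign zero    = 1#
  altSign (suc j) = - altSign j

  det : ∀ n → Matrix n n → Carrier
  det zero    A = 1#
  det (suc n) A = sumFin (suc n) λ j →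
    altSign j * (A zero j * det n (λ r s → A (suc r) (punchIn j s)))

  record WGraph : Set (lsuc 0ℓ ⊔ c) where
    field
      White  : Set
      Black  : Set
      _≟W_   : DecidableEquality White
      _≟B_   : DecidableEquality Black
      whites : List White   -- enumeration of all white vertices (no repeats)
      blacks : List Black   -- enumeration of all black vertices (no repeats)
      edges  : List (White × Black × Carrier)

  -- all sub-lists (= all subsets of the edge multiset, by position)
  sublists : ∀ {A : Set c} → List A → List (List A)
  sublists []       = [] ∷ []
  sublists (x ∷ xs) = sublists xs ++ map (x ∷_) (sublists xs)

  M : WGraph → Carrier
  M G = sumL (map term (sublists edges))
    where
    open WGraph G
    degW : List (White × Black × Carrier) → White → ℕ
    degW L w = length (filter (λ e → proj₁ e ≟W w) L)
    degB : List (White × Black × Carrier) → Black → ℕ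
    degB L b = length (filter (λ e → proj₁ (proj₂ e) ≟B b) L)
    isPerfectMatching : List (White × Black × Carrier) → Bool
    isPerfectMatching L = and (map (λ w → degW L w ≡ᵇ 1) whites) ∧ and (map (λ b → degB L b ≡ᵇ 1) blacks)
    term : List (White × Black × Carrier) → Carrier
    term L = if isPerfectMatching L then prodL (map (λ e → proj₂ (proj₂ e)) L) else 0#

  record Strand (k l : ℕ) : Set c where
    field
      edge        : Fin k → Fin l → Bool
      weight      : Fin k → Fin l → Carrier
      nonCrossing : NonCrossing edge
      caterpillar : IsCaterpillar edge

  biadj : ∀ {k l} → Strand k l → Matrix k l
  biadj S p q = if Strand.edge S p q then Strand.weight S p q else 0#

  strandEdges : ∀ {k l} → Strand k l → List (Fin k × Fin l × Carrier)
  strandEdges {k} {l} S =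
    concatMap (λ p → concatMap (λ q →
      if Strand.edge S p q then (p , q , Strand.weight S p q) ∷ [] else []) (allFin l)) (allFin k)

  -- A stack of strands S_1 (bottom), ..., S_m (top), with l_i = k_{i+1}.
  -- Fabric a b : S_1 has a bottom vertices, S_m has b top vertices.

  data Fabric : ℕ → ℕ → Set c where
    [_]  : ∀ {a b} → Strand a b → Fabric a b
    _▷_  : ∀ {a b d} → Strand a b → Fabric b d → Fabric a d

  len : ∀ {a b} → Fabric a b → ℕ
  len [ S ]   = 1
  len (S ▷ F) = suc (len F)

  lastIdx : ∀ {a b} (F : Fabric a b) → Fin (len F)
  lastIdx [ S ]   = zero
  lastIdx (S ▷ F) = suc (lastIdx F)

  -- l_i = number of top vertices of S_i  (index i : Fin m is 0-based)
  topSize : ∀ {a b} (F : Fabric a b) → Fin (len F) → ℕ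
  topSize ([_] {b = b} S) zero     = b
  topSize (_▷_ {b = b} S F) zero    = b
  topSize (S ▷ F) (suc i) = topSize F i

  prodA : ∀ {a b} → Fabric a b → Matrix a b
  prodA [ S ]   = biadj S
  prodA (S ▷ F) = biadj S ⊗ prodA F

  WhiteF : ∀ {a b} → Fabric a b → Set
  WhiteF ([_] {a} S)   = Fin a
  WhiteF (_▷_ {a} S F) = Fin a ⊎ WhiteF F

  BlackF : ∀ {a b} → Fabric a b → Set
  BlackF ([_] {b = b} S)   = Fin b
  BlackF (_▷_ {b = b} S F) = Fin b ⊎ BlackF F

  decW : ∀ {a b} (F : Fabric a b) → DecidableEquality (WhiteF F)
  decW [ S ]   = _≟ᶠ_
  decW (S ▷ F) = ≡-dec _≟ᶠ_ (decW F)

  decB : ∀ {a b} (F : Fabric a b) → DecidableEquality (BlackF F)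
  decB [ S ]   = _≟ᶠ_
  decB (S ▷ F) = ≡-dec _≟ᶠ_ (decB F)

  whitesF : ∀ {a b} (F : Fabric a b) → List (WhiteF F)
  whitesF ([_] {a} S)   = allFin a
  whitesF (_▷_ {a} S F) = map inj₁ (allFin a) ++ map inj₂ (whitesF F)

  blacksF : ∀ {a b} (F : Fabric a b) → List (BlackF F)
  blacksF ([_] {b = b} S)   = allFin b
  blacksF (_▷_ {b = b} S F) = map inj₁ (allFin b) ++ map inj₂ (blacksF F)

  bottomV : ∀ {a b} (F : Fabric a b) → Fin a → WhiteF F
  bottomV [ S ]   j = j
  bottomV (S ▷ F) j = inj₁ j

  topV : ∀ {a b} (F : Fabric a b) → Fin b → BlackF F
  topV [ S ]   j = j
  topV (S ▷ F) j = inj₂ (topV F j)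

  -- all edges of the stacked graph; x i (i : Fin m, 0-based) is the weight of
  -- the vertical edges joining the top of S_{i+1} to the bottom of S_{i+2}
  -- (the value x (lastIdx F) is not used here)
  stackEdges : ∀ {a b} (F : Fabric a b) → (Fin (len F) → Carrier) →
               List (WhiteF F × BlackF F × Carrier)
  stackEdges [ S ]   x = strandEdges S
  stackEdges (_▷_ {b = b} S F) x =
       map (λ e → inj₁ (proj₁ e) , inj₁ (proj₁ (proj₂ e)) , proj₂ (proj₂ e)) (strandEdges S)
    ++ map (λ j → inj₂ (bottomV F j) , inj₁ j , x zero) (allFin b)
    ++ map (λ e → inj₂ (proj₁ e) , inj₂ (proj₁ (proj₂ e)) , proj₂ (proj₂ e))
           (stackEdges F (λ i → x (suc i)))

  rectGraph : ∀ {a b} → Fabric a b → WGraph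
  rectGraph F = record
    { White = WhiteF F ; Black = BlackF F ; _≟W_ = decW F ; _≟B_ = decB F
    ; whites = whitesF F ; blacks = blacksF F
    ; edges = stackEdges F (λ _ → 1#) }

  -- cylindrical fabric graph with vertical weights x_1..x_m
  -- (x (lastIdx F) = x_m is the weight of the edges from S_m back to S_1)
  cylGraph : ∀ {a} (F : Fabric a a) → (Fin (len F) → Carrier) → WGraph
  cylGraph {a} F x = record
    { White = WhiteF F ; Black = BlackF F ; _≟W_ = decW F ; _≟B_ = decB F
    ; whites = whitesF F ; blacks = blacksF F
    ; edges = stackEdges F x
              ++ map (λ j → bottomV F j , topV F j , x (lastIdx F)) (allFin a) }

{-# OPTIONS --safe #-}

-- Let Λ(A) be the map induced by a matrix A on exterior algebras; its entries are the
-- minors of A, and Λ(AB) is the composite of Λ(A) and Λ(B).  For a strand the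
-- non-crossing condition removes all signs, so the minors of A_i count the matchings
-- of S_i covering prescribed vertices.  Deciding which vertical edges are used makes
-- the matchings of the stacked graph the entries of the composite of the Λ(A_i),
-- interleaved with diagonal maps multiplying a monomial with index set K by x_i to
-- the number of elements outside K.  The top entry of Λ(A) is det A; closing
-- up the cylinder takes a trace, and det(yI + A) is the trace of Λ(A) weighted by
-- y^(n - |K|).  As each Λ(A_i) preserves degrees, the powers of the x_i can be
-- collected in every degree separately.

module Submission where

open import Defs
open import Level using (Level)
open import Algebra.Bundles using (CommutativeRing)
open import Data.Bool.Base using (Bool; true; false; if_then_else_; not; _∧_; T)
open import Data.Bool.ListAction using (and)
open import Data.Bool.Properties using (T?; ∧-comm; ∧-assoc; ∧-zeroʳ)
open import Data.Nat.Base using (ℕ; zero; suc; _∸_; _≡ᵇ_; _≤_; z≤n; s≤s) renaming (_+_ to _+ℕ_)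
import Data.Nat.Properties as ℕ
open import Data.Fin.Base using (Fin; zero; suc; punchIn) renaming (_<_ to _<ᶠ_)
open import Data.Fin.Properties using (any?) renaming (_≟_ to _≟ᶠ_)
open import Data.List.Base
  using (List; []; _∷_; _++_; map; concatMap; filter; length; tabulate; allFin)
open import Data.List.Properties using (map-++; map-cong; map-tabulate; map-∘)
open import Data.List.Membership.Propositional using (_∈_)
open import Data.List.Membership.Propositional.Properties using (∈-allFin; ∈-map⁺; ∈-++⁺ˡ; ∈-++⁺ʳ)
open import Data.List.Relation.Binary.Permutation.Propositional as ↭ using (_↭_)
open import Data.List.Relation.Binary.Permutation.Propositional.Properties using (++-comm; shifts)
open import Data.List.Relation.Unary.Any using (here; there)
open import Data.Product.Base using (_×_; _,_; proj₁; proj₂)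
open import Data.Sum.Base as Sum using (_⊎_; inj₁; inj₂; [_,_]′)
open import Data.Sum.Properties using (≡-dec)
open import Data.Vec.Base using (Vec; []; _∷_; lookup; replicate; insertAt; _[_]≔_)
open import Data.Vec.Properties using (lookup-replicate)
open import Function.Base using (id; _∘_; const)
open import Relation.Binary.Definitions using (DecidableEquality)
open import Relation.Nullary using (¬_; yes; no; does)
open import Relation.Binary.PropositionalEquality as ≡ using (_≡_; _≢_; _≗_)

-- Index sets as Boolean vectors.

full : ∀ {n} → Vec Bool n
full = replicate _ true

ones zeros : ∀ {n} → Vec Bool n → ℕ
ones []          = 0
ones (false ∷ K) = ones K
ones (true ∷ K)  = suc (ones K)
zeros []          = 0
zeros (false ∷ K) = suc (zeros K)
zeros (true ∷ K)  = zeros K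

-- Exterior algebra in the monomial basis, and its linear maps.

module Exterior {c ℓ : Level} (R : CommutativeRing c ℓ) where
  open CommutativeRing R hiding (zero)
  open import Relation.Binary.Reasoning.Setoid setoid
  open import Algebra.Properties.Ring ring using (-1*x≈-x; -‿involutive)
  open import Algebra.Properties.CommutativeSemigroup +-commutativeSemigroup
    using () renaming (interchange to +-interchange)
  open import Algebra.Solver.Ring.NaturalCoefficients.Default commutativeSemiring

  Vector : ℕ → Set c
  Vector n = Fin n → Carrier

  -- An element of the exterior algebra on n generators, as the family of its
  -- coefficients in the monomial basis.
  Λ : ℕ → Set c
  Λ n = Vec Bool n → Carrier

  infix 4 _≋_
  _≋_ : ∀ {n} → Λ n → Λ n → Set ℓ
  ω ≋ η = ∀ K → ω K ≈ η K

  infixl 6 _⊞_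
  _⊞_ : ∀ {n} → Λ n → Λ n → Λ n
  (ω ⊞ η) K = ω K + η K

  infixr 7 _⊡_
  _⊡_ : ∀ {n} → Carrier → Λ n → Λ n
  (r ⊡ ω) K = r * ω K

  𝟎 one : ∀ {n} → Λ n
  𝟎 K = 0#
  one []          = 1#
  one (false ∷ K) = one K
  one (true ∷ K)  = 0#

  -- `lo` includes the algebra on the later generators, `hi` multiplies this inclusion on the left
  -- by the first generator.
  lo hi : ∀ {n} → Λ n → Λ (suc n)
  lo ω (false ∷ K) = ω K
  lo ω (true ∷ K)  = 0#
  hi ω (false ∷ K) = 0#
  hi ω (true ∷ K)  = ω K

  basis : ∀ {n} → Vec Bool n → Λ n
  basis []          K = 1#
  basis (false ∷ I) K = lo (basis I) K
  basis (true ∷ I)  K = hi (basis I) K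

  sumVec : ∀ n → Λ n → Carrier
  sumVec zero    f = f []
  sumVec (suc n) f = sumVec n (λ K → f (false ∷ K)) + sumVec n (λ K → f (true ∷ K))

  sumVec-cong : ∀ n {f g : Λ n} → f ≋ g → sumVec n f ≈ sumVec n g
  sumVec-cong zero    p = p []
  sumVec-cong (suc n) p =
    +-cong (sumVec-cong n (λ K → p (false ∷ K))) (sumVec-cong n (λ K → p (true ∷ K)))

  *-sumVec : ∀ n r (f : Λ n) → r * sumVec n f ≈ sumVec n (r ⊡ f)
  *-sumVec zero    r f = refl
  *-sumVec (suc n) r f = trans (distribˡ _ _ _) (+-cong (*-sumVec n r _) (*-sumVec n r _))

  sumFin-cong : ∀ n {f g : Vector n} → (∀ i → f i ≈ g i) → sumFin R n f ≈ sumFin R n g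
  sumFin-cong zero    p = refl
  sumFin-cong (suc n) p = +-cong (p zero) (sumFin-cong n (λ i → p (suc i)))

  *-sumFin : ∀ n r (f : Vector n) → r * sumFin R n f ≈ sumFin R n (λ i → r * f i)
  *-sumFin zero    r f = zeroʳ r
  *-sumFin (suc n) r f = trans (distribˡ _ _ _) (+-congˡ (*-sumFin n r _))

  sumFin-zero : ∀ n (f : Vector n) → (∀ i → f i ≈ 0#) → sumFin R n f ≈ 0#
  sumFin-zero zero    f p = refl
  sumFin-zero (suc n) f p =
    trans (+-cong (p zero) (sumFin-zero n _ (λ i → p (suc i)))) (+-identityˡ 0#)

  record Linear {m n} (T : Λ m → Λ n) : Set (c Level.⊔ ℓ) where
    field
      T-cong : ∀ {ω η} → ω ≋ η → T ω ≋ T η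
      T-⊞    : ∀ ω η → T (ω ⊞ η) ≋ T ω ⊞ T η
      T-⊡    : ∀ r ω → T (r ⊡ ω) ≋ r ⊡ T ω

    T-𝟎 : T 𝟎 ≋ 𝟎
    T-𝟎 K = trans (T-cong (λ _ → sym (zeroˡ 0#)) K) (trans (T-⊡ 0# 𝟎 K) (zeroˡ _))

  open Linear public

  Avoids : ∀ {n} → Fin n → Λ n → Set ℓ
  Avoids q ω = ∀ K → lookup K q ≡ true → ω K ≈ 0#

  -- The degrees of ω are d ∸ j; the offset j keeps the recursion over coordinates
  -- free of the predecessor of d.
  Homogeneous : ∀ {n} → ℕ → ℕ → Λ n → Set ℓ
  Homogeneous j d ω = ∀ K → j +ℕ ones K ≢ d → ω K ≈ 0#

  id-linear : ∀ {n} → Linear {n} id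
  id-linear = record { T-cong = id ; T-⊞ = λ _ _ _ → refl ; T-⊡ = λ _ _ _ → refl }

  ∘-linear : ∀ {l m n} {S : Λ m → Λ n} {T : Λ l → Λ m} → Linear S → Linear T → Linear (S ∘ T)
  ∘-linear LS LT = record
    { T-cong = λ p → T-cong LS (T-cong LT p)
    ; T-⊞    = λ ω η K → trans (T-cong LS (T-⊞ LT ω η) K) (T-⊞ LS _ _ K)
    ; T-⊡    = λ r ω K → trans (T-cong LS (T-⊡ LT r ω) K) (T-⊡ LS _ _ K) }

  ⊞-linear : ∀ {m n} {S T : Λ m → Λ n} → Linear S → Linear T → Linear (λ ω → S ω ⊞ T ω)
  ⊞-linear LS LT = record
    { T-cong = λ p K → +-cong (T-cong LS p K) (T-cong LT p K)
    ; T-⊞    = λ ω η K → trans (+-cong (T-⊞ LS ω η K) (T-⊞ LT ω η K)) (+-interchange _ _ _ _)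
    ; T-⊡    = λ r ω K → trans (+-cong (T-⊡ LS r ω K) (T-⊡ LT r ω K)) (sym (distribˡ _ _ _)) }

  restrict-linear : ∀ {n} b → Linear {suc n} {n} (λ ω K → ω (b ∷ K))
  restrict-linear b = record
    { T-cong = λ p K → p (b ∷ K) ; T-⊞ = λ _ _ _ → refl ; T-⊡ = λ _ _ _ → refl }

  lo-linear : ∀ {n} → Linear (lo {n})
  lo-linear = record
    { T-cong = λ { p (false ∷ K) → p K ; p (true ∷ K) → refl }
    ; T-⊞    = λ { _ _ (false ∷ K) → refl ; _ _ (true ∷ K) → sym (+-identityˡ 0#) }
    ; T-⊡    = λ { _ _ (false ∷ K) → refl ; r _ (true ∷ K) → sym (zeroʳ r) } }

  hi-linear : ∀ {n} → Linear (hi {n})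
  hi-linear = record
    { T-cong = λ { p (false ∷ K) → refl ; p (true ∷ K) → p K }
    ; T-⊞    = λ { _ _ (false ∷ K) → sym (+-identityˡ 0#) ; _ _ (true ∷ K) → refl }
    ; T-⊡    = λ { r _ (false ∷ K) → sym (zeroʳ r) ; _ _ (true ∷ K) → refl } }

  linear-expand : ∀ {m n} {T : Λ m → Λ n} → Linear T → ∀ ω J →
                  T ω J ≈ sumVec m (λ K → ω K * T (basis K) J)
  linear-expand {zero} {T = T} L ω J = begin
    T ω J                   ≈⟨ T-cong L (λ { [] → sym (*-identityʳ _) }) J ⟩
    T (ω [] ⊡ basis []) J   ≈⟨ T-⊡ L _ _ J ⟩
    ω [] * T (basis []) J   ∎
  linear-expand {suc m} {T = T} L ω J = begin
    T ω J
      ≈⟨ T-cong L (λ { (false ∷ K) → sym (+-identityʳ _) ; (true ∷ K) → sym (+-identityˡ _) }) J ⟩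
    T (lo (λ K → ω (false ∷ K)) ⊞ hi (λ K → ω (true ∷ K))) J
      ≈⟨ T-⊞ L _ _ J ⟩
    T (lo (λ K → ω (false ∷ K))) J + T (hi (λ K → ω (true ∷ K))) J
      ≈⟨ +-cong (linear-expand (∘-linear L lo-linear) _ J)
                (linear-expand (∘-linear L hi-linear) _ J) ⟩
    sumVec m (λ K → ω (false ∷ K) * T (lo (basis K)) J) +
    sumVec m (λ K → ω (true ∷ K) * T (hi (basis K)) J)
      ≈⟨ +-cong (sumVec-cong m (λ K → *-congˡ (T-cong L (λ _ → refl) J)))
                (sumVec-cong m (λ K → *-congˡ (T-cong L (λ _ → refl) J))) ⟩
    sumVec (suc m) (λ K → ω K * T (basis K) J) ∎

  -- The algebra generated by e₁, …, eₙ with eᵢ² = 0 and eⱼ eᵢ = ε eᵢ eⱼ for i < j: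
  -- the exterior algebra for ε = -1, and its commutative analogue, which computes
  -- permanents instead of determinants, for ε = 1.
  module Twisted (ε : Carrier) where

    infixr 7 _⋏_
    -- Left multiplication by a vector. A monomial containing e₁ arises from the e₁-component of
    -- `v`, or from a later component that is moved past an e₁ already present in `ω`; the latter
    -- costs the factor `ε`.
    _⋏_ : ∀ {n} → Vector n → Λ n → Λ n
    (v ⋏ ω) []          = 0#
    (v ⋏ ω) (false ∷ K) = ((v ∘ suc) ⋏ (λ L → ω (false ∷ L))) K
    (v ⋏ ω) (true ∷ K)  = v zero * ω (false ∷ K) + ε * ((v ∘ suc) ⋏ (λ L → ω (true ∷ L))) K

    ⋏-cong : ∀ {n} {u v : Vector n} {ω η : Λ n} → (∀ i → u i ≈ v i) → ω ≋ η → u ⋏ ω ≋ v ⋏ η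
    ⋏-cong p q []          = refl
    ⋏-cong p q (false ∷ K) = ⋏-cong (p ∘ suc) (λ L → q (false ∷ L)) K
    ⋏-cong p q (true ∷ K)  =
      +-cong (*-cong (p zero) (q _)) (*-congˡ (⋏-cong (p ∘ suc) (λ L → q (true ∷ L)) K))

    ⋏-linear : ∀ {n} (v : Vector n) → Linear (v ⋏_)
    ⋏-linear v = record { T-cong = ⋏-cong (λ _ → refl) ; T-⊞ = add v ; T-⊡ = scale v }
      where
      add : ∀ {n} (v : Vector n) ω η → v ⋏ (ω ⊞ η) ≋ v ⋏ ω ⊞ v ⋏ η
      add v ω η []          = sym (+-identityˡ 0#)
      add v ω η (false ∷ K) = add (v ∘ suc) _ _ K
      add v ω η (true ∷ K)  = trans (+-congˡ (*-congˡ (add (v ∘ suc) _ _ K)))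
        (solve 6 (λ a x y e z w → a :* (x :+ y) :+ e :* (z :+ w)
                               := (a :* x :+ e :* z) :+ (a :* y :+ e :* w)) refl _ _ _ _ _ _)

      scale : ∀ {n} (v : Vector n) r ω → v ⋏ (r ⊡ ω) ≋ r ⊡ v ⋏ ω
      scale v r ω []          = sym (zeroʳ r)
      scale v r ω (false ∷ K) = scale (v ∘ suc) r _ K
      scale v r ω (true ∷ K)  = trans (+-congˡ (*-congˡ (scale (v ∘ suc) r _ K)))
        (solve 5 (λ a r x e z → a :* (r :* x) :+ e :* (r :* z)
                             := r :* (a :* x :+ e :* z)) refl _ _ _ _ _)

    ⋏-addˡ : ∀ {n} (u v : Vector n) ω → (λ i → u i + v i) ⋏ ω ≋ u ⋏ ω ⊞ v ⋏ ω
    ⋏-addˡ u v ω []          = sym (+-identityˡ 0#)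
    ⋏-addˡ u v ω (false ∷ K) = ⋏-addˡ (u ∘ suc) (v ∘ suc) _ K
    ⋏-addˡ u v ω (true ∷ K)  = trans (+-congˡ (*-congˡ (⋏-addˡ (u ∘ suc) (v ∘ suc) _ K)))
      (solve 6 (λ a b x e z w → (a :+ b) :* x :+ e :* (z :+ w)
                             := (a :* x :+ e :* z) :+ (b :* x :+ e :* w)) refl _ _ _ _ _ _)

    ⋏-scaleˡ : ∀ {n} r (v : Vector n) ω → (λ i → r * v i) ⋏ ω ≋ r ⊡ v ⋏ ω
    ⋏-scaleˡ r v ω []          = sym (zeroʳ r)
    ⋏-scaleˡ r v ω (false ∷ K) = ⋏-scaleˡ r (v ∘ suc) _ K
    ⋏-scaleˡ r v ω (true ∷ K)  = trans (+-congˡ (*-congˡ (⋏-scaleˡ r (v ∘ suc) _ K)))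
      (solve 5 (λ r a x e z → (r :* a) :* x :+ e :* (r :* z)
                           := r :* (a :* x :+ e :* z)) refl _ _ _ _ _)

    ⋏-zeroˡ : ∀ {n} {v : Vector n} → (∀ i → v i ≈ 0#) → ∀ ω → v ⋏ ω ≋ 𝟎
    ⋏-zeroˡ p ω K = trans
      (⋏-cong {ω = ω} (λ i → trans (p i) (sym (zeroˡ 0#))) (λ _ → refl) K)
      (trans (⋏-scaleˡ 0# (λ _ → 0#) ω K) (zeroˡ _))

    ⋏-zeroʳ : ∀ {n} (v : Vector n) {ω} → ω ≋ 𝟎 → v ⋏ ω ≋ 𝟎
    ⋏-zeroʳ v p K = trans (T-cong (⋏-linear v) p K) (T-𝟎 (⋏-linear v) K)

    -- The algebra map sending the p-th generator to the p-th row of A.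
    ext : ∀ {k l} → Matrix R k l → Λ k → Λ l
    ext {zero}  A ω = ω [] ⊡ one
    ext {suc k} A ω =
      ext (A ∘ suc) (λ K → ω (false ∷ K)) ⊞ A zero ⋏ ext (A ∘ suc) (λ K → ω (true ∷ K))

    ext-linear : ∀ {k l} (A : Matrix R k l) → Linear (ext A)
    ext-linear {zero} A = record
      { T-cong = λ p J → *-congʳ (p [])
      ; T-⊞    = λ ω η J → distribʳ _ _ _
      ; T-⊡    = λ r ω J → *-assoc _ _ _ }
    ext-linear {suc k} A = ⊞-linear
      (∘-linear (ext-linear (A ∘ suc)) (restrict-linear false))
      (∘-linear (⋏-linear (A zero)) (∘-linear (ext-linear (A ∘ suc)) (restrict-linear true)))

    one-row : ∀ {k l} (A : Matrix R k l) → ext A one ≋ one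
    one-row {zero}  A J = *-identityˡ _
    one-row {suc k} A J = trans
      (+-cong (one-row (A ∘ suc) J) (⋏-zeroʳ (A zero) (T-𝟎 (ext-linear (A ∘ suc))) J))
      (+-identityʳ _)

    ⋏-avoids : ∀ {n} {q : Fin n} {v ω} → v q ≈ 0# → Avoids q ω → Avoids q (v ⋏ ω)
    ⋏-avoids {q = zero} p a (true ∷ K) ≡.refl = trans
      (+-cong (trans (*-congʳ p) (zeroˡ _))
              (trans (*-congˡ (⋏-zeroʳ _ (λ L → a (true ∷ L) ≡.refl) K)) (zeroʳ ε)))
      (+-identityˡ 0#)
    ⋏-avoids {q = suc q} p a (false ∷ K) t = ⋏-avoids p (λ L → a (false ∷ L)) K t
    ⋏-avoids {q = suc q} p a (true ∷ K)  t = trans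
      (+-cong (trans (*-congˡ (a (false ∷ K) t)) (zeroʳ _))
              (trans (*-congˡ (⋏-avoids p (λ L → a (true ∷ L)) K t)) (zeroʳ ε)))
      (+-identityˡ 0#)

    ext-avoids : ∀ {k l} {A : Matrix R k l} {q} → (∀ p → A p q ≈ 0#) → ∀ ω → Avoids q (ext A ω)
    ext-avoids {zero} {q = q} p ω K t = trans (*-congˡ (one-avoids q K t)) (zeroʳ _)
      where
      one-avoids : ∀ {n} (q : Fin n) → Avoids q one
      one-avoids zero    (true ∷ K)  t = refl
      one-avoids (suc q) (false ∷ K) t = one-avoids q K t
      one-avoids (suc q) (true ∷ K)  t = refl
    ext-avoids {suc k} p ω K t = trans
      (+-cong (ext-avoids (p ∘ suc) _ K t)
              (⋏-avoids (p zero) (ext-avoids (p ∘ suc) _) K t))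
      (+-identityˡ 0#)

    -- Multiplying by a vector raises the degree d - j by one, which lowers the offset by one.
    ⋏-homogeneous : ∀ {n j d} (v : Vector n) {ω} → Homogeneous (suc j) d ω → Homogeneous j d (v ⋏ ω)
    ⋏-homogeneous         v h []          j≢d = refl
    ⋏-homogeneous         v h (false ∷ K) j≢d = ⋏-homogeneous (v ∘ suc) (λ L → h (false ∷ L)) K j≢d
    ⋏-homogeneous {j = j} v h (true ∷ K)  j≢d = trans
      (+-cong (trans (*-congˡ (h (false ∷ K) j+1≢d)) (zeroʳ _))
              (trans (*-congˡ (⋏-homogeneous (v ∘ suc) tail K j+1≢d)) (zeroʳ ε)))
      (+-identityˡ 0#)
      where
      j+1≢d = λ eq → j≢d (≡.trans (ℕ.+-suc j (ones K)) eq)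
      tail : Homogeneous (suc (suc j)) _ _
      tail L L≢d = h (true ∷ L) (λ eq → L≢d (≡.trans (≡.cong suc (≡.sym (ℕ.+-suc j (ones L)))) eq))

    ext-homogeneous : ∀ {k l j d} (A : Matrix R k l) {ω} →
                      Homogeneous j d ω → Homogeneous j d (ext A ω)
    ext-homogeneous {zero} {j = j} {d} A {ω} h K K≢d = go K K≢d
      where
      go : ∀ {n} (K : Vec Bool n) → j +ℕ ones K ≢ d → ω [] * one K ≈ 0#
      go []          j≢d = trans (*-congʳ (h [] j≢d)) (zeroˡ _)
      go (false ∷ K) j≢d = go K j≢d
      go (true ∷ K)  j≢d = zeroʳ _
    ext-homogeneous {suc k} {j = j} A h K K≢d = trans
      (+-cong (ext-homogeneous (A ∘ suc) (λ L → h (false ∷ L)) K K≢d)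
              (⋏-homogeneous (A zero) (ext-homogeneous (A ∘ suc) tail) K K≢d))
      (+-identityˡ 0#)
      where
      tail : Homogeneous (suc j) _ _
      tail L L≢d = h (true ∷ L) (λ eq → L≢d (≡.trans (≡.sym (ℕ.+-suc j (ones L))) eq))

  basis-homogeneous : ∀ {n} (I : Vec Bool n) → Homogeneous 0 (ones I) (basis I)
  basis-homogeneous []          []          I≢I with () ← I≢I ≡.refl
  basis-homogeneous (false ∷ I) (false ∷ K) K≢I = basis-homogeneous I K K≢I
  basis-homogeneous (false ∷ I) (true ∷ K)  K≢I = refl
  basis-homogeneous (true ∷ I)  (false ∷ K) K≢I = refl
  basis-homogeneous (true ∷ I)  (true ∷ K)  K≢I = basis-homogeneous I K (K≢I ∘ ≡.cong suc)

  -- Sign rules and minors of a product.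

  -1² : - 1# * - 1# ≈ 1#
  -1² = trans (-1*x≈-x (- 1#)) (-‿involutive 1#)

  open Twisted (- 1#)
  module Perm = Twisted 1#

  cancel : ∀ x → x + - 1# * x ≈ 0#
  cancel x = trans (+-congˡ (-1*x≈-x x)) (-‿inverseʳ x)

  ⋏-anticomm : ∀ {n} (u v : Vector n) ω → u ⋏ (v ⋏ ω) ≋ - 1# ⊡ v ⋏ (u ⋏ ω)
  ⋏-anticomm u v ω []          = sym (zeroʳ _)
  ⋏-anticomm u v ω (false ∷ K) = ⋏-anticomm (u ∘ suc) (v ∘ suc) _ K
  ⋏-anticomm u v ω (true ∷ K)  = begin
    u₀ * V + e * (u′ ⋏ (v₀ ⊡ ω₀ ⊞ e ⊡ v′ ⋏ ω₁)) K
      ≈⟨ +-congˡ (*-congˡ (expand u′ v₀ v′)) ⟩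
    u₀ * V + e * (v₀ * U + e * (u′ ⋏ (v′ ⋏ ω₁)) K)
      ≈⟨ +-congˡ (*-congˡ (+-congˡ (*-congˡ (⋏-anticomm u′ v′ ω₁ K)))) ⟩
    u₀ * V + e * (v₀ * U + e * (e * W))
      -- The missing coefficient 1 is written as (-1)². After that both sides agree as polynomials
      -- in `e`, and the semiring solver suffices.
      ≈⟨ +-congʳ (sym (*-identityˡ _)) ⟩
    1# * (u₀ * V) + e * (v₀ * U + e * (e * W))
      ≈⟨ +-congʳ (*-congʳ (sym -1²)) ⟩
    e * e * (u₀ * V) + e * (v₀ * U + e * (e * W))
      ≈⟨ solve 6 (λ e u₀ V v₀ U W → e :* e :* (u₀ :* V) :+ e :* (v₀ :* U :+ e :* (e :* W))
                                 := e :* (v₀ :* U :+ e :* (u₀ :* V :+ e :* W)))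
               refl e u₀ V v₀ U W ⟩
    e * (v₀ * U + e * (u₀ * V + e * W))
      ≈⟨ *-congˡ (+-congˡ (*-congˡ (expand v′ u₀ u′))) ⟨
    e * (v₀ * U + e * (v′ ⋏ (u₀ ⊡ ω₀ ⊞ e ⊡ u′ ⋏ ω₁)) K) ∎
    where
    e = - 1#
    u₀ = u zero
    v₀ = v zero
    u′ = u ∘ suc
    v′ = v ∘ suc
    ω₀ = λ L → ω (false ∷ L)
    ω₁ = λ L → ω (true ∷ L)
    U = (u′ ⋏ ω₀) K
    V = (v′ ⋏ ω₀) K
    W = (v′ ⋏ (u′ ⋏ ω₁)) K
    expand : ∀ a r b → (a ⋏ (r ⊡ ω₀ ⊞ e ⊡ b ⋏ ω₁)) K ≈ r * (a ⋏ ω₀) K + e * (a ⋏ (b ⋏ ω₁)) K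
    expand a r b = trans (T-⊞ (⋏-linear a) _ _ K)
      (+-cong (T-⊡ (⋏-linear a) r ω₀ K) (T-⊡ (⋏-linear a) e (b ⋏ ω₁) K))

  -- Anticommutativity only shows that twice the left side vanishes, which is weaker in a general
  -- ring; hence a separate induction, in which the two terms containing e₁ cancel.
  ⋏-square : ∀ {n} (v : Vector n) ω → v ⋏ (v ⋏ ω) ≋ 𝟎
  ⋏-square v ω []          = refl
  ⋏-square v ω (false ∷ K) = ⋏-square (v ∘ suc) _ K
  ⋏-square v ω (true ∷ K)  = begin
    v₀ * V + - 1# * (v′ ⋏ (v₀ ⊡ ω₀ ⊞ - 1# ⊡ v′ ⋏ ω₁)) K
      ≈⟨ +-congˡ (*-congˡ (trans (T-⊞ (⋏-linear v′) _ _ K)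
           (+-cong (T-⊡ (⋏-linear v′) v₀ ω₀ K) (T-⊡ (⋏-linear v′) (- 1#) (v′ ⋏ ω₁) K)))) ⟩
    v₀ * V + - 1# * (v₀ * V + - 1# * (v′ ⋏ (v′ ⋏ ω₁)) K)
      ≈⟨ +-congˡ (*-congˡ (+-congˡ (trans (*-congˡ (⋏-square v′ ω₁ K)) (zeroʳ _)))) ⟩
    v₀ * V + - 1# * (v₀ * V + 0#)
      ≈⟨ +-congˡ (*-congˡ (+-identityʳ _)) ⟩
    v₀ * V + - 1# * (v₀ * V)
      ≈⟨ cancel _ ⟩
    0# ∎
    where
    v₀ = v zero
    v′ = v ∘ suc
    ω₀ = λ L → ω (false ∷ L)
    ω₁ = λ L → ω (true ∷ L)
    V = (v′ ⋏ ω₀) K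

  infixl 7 _⋆_
  _⋆_ : ∀ {k l} → Vector k → Matrix R k l → Vector l
  (v ⋆ B) j = sumFin R _ (λ t → v t * B t j)

  -- This is multiplicativity of `ext B`, with `v ⋆ B` the image of `v`. Moving the later part of
  -- `v` past the first generator and moving its image `w` past the row `b` cost the same sign, so
  -- the signs cancel.
  ext-⋏ : ∀ {k l} (B : Matrix R k l) v ω → ext B (v ⋏ ω) ≋ (v ⋆ B) ⋏ ext B ω
  ext-⋏ {zero}  B v ω J = trans (zeroˡ _) (sym (⋏-zeroˡ (λ _ → refl) (ext B ω) J))
  ext-⋏ {suc k} B v ω J = begin
    ext B′ (v′ ⋏ ω₀) J + (b ⋏ ext B′ (v₀ ⊡ ω₀ ⊞ - 1# ⊡ v′ ⋏ ω₁)) J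
      ≈⟨ +-cong (ext-⋏ B′ v′ ω₀ J) (trans (T-⊞ L _ _ J)
           (+-cong (T-⊡ L v₀ ω₀ J) (T-⊡ L (- 1#) (v′ ⋏ ω₁) J))) ⟩
    (w ⋏ Ω₀) J + (v₀ * (b ⋏ Ω₀) J + - 1# * (b ⋏ ext B′ (v′ ⋏ ω₁)) J)
      ≈⟨ +-congˡ (+-congˡ (*-congˡ (trans (⋏-cong (λ _ → refl) (ext-⋏ B′ v′ ω₁) J)
                                          (⋏-anticomm b w Ω₁ J)))) ⟩
    (w ⋏ Ω₀) J + (v₀ * (b ⋏ Ω₀) J + - 1# * (- 1# * W))
      ≈⟨ +-congˡ (+-congˡ (trans (sym (*-assoc _ _ _)) (trans (*-congʳ -1²) (*-identityˡ _)))) ⟩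
    (w ⋏ Ω₀) J + (v₀ * (b ⋏ Ω₀) J + W)
      -- The zero summand is a placeholder for `b ⋏ (b ⋏ Ω₁)`; with it, `b` is multiplied by
      -- `Ω₀ ⊞ b ⋏ Ω₁`, which is `ext B ω`.
      ≈⟨ solve 4 (λ x v y z → x :+ (v :* y :+ z) := (v :* y :+ v :* con 0) :+ (x :+ z))
               refl _ v₀ _ _ ⟩
    (v₀ * (b ⋏ Ω₀) J + v₀ * 0#) + ((w ⋏ Ω₀) J + W)
      ≈⟨ +-cong (+-congˡ (*-congˡ (sym (⋏-square b Ω₁ J)))) (sym (T-⊞ (⋏-linear w) _ _ J)) ⟩
    (v₀ * (b ⋏ Ω₀) J + v₀ * (b ⋏ (b ⋏ Ω₁)) J) + (w ⋏ (Ω₀ ⊞ b ⋏ Ω₁)) J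
      ≈⟨ +-congʳ (trans (sym (distribˡ _ _ _)) (*-congˡ (sym (T-⊞ (⋏-linear b) _ _ J)))) ⟩
    v₀ * (b ⋏ (Ω₀ ⊞ b ⋏ Ω₁)) J + (w ⋏ (Ω₀ ⊞ b ⋏ Ω₁)) J
      ≈⟨ +-congʳ (⋏-scaleˡ v₀ b _ J) ⟨
    ((λ j → v₀ * b j) ⋏ (Ω₀ ⊞ b ⋏ Ω₁)) J + (w ⋏ (Ω₀ ⊞ b ⋏ Ω₁)) J
      ≈⟨ ⋏-addˡ (λ j → v₀ * b j) w _ J ⟨
    ((v ⋆ B) ⋏ ext B ω) J ∎
    where
    b = B zero
    B′ = B ∘ suc
    v₀ = v zero
    v′ = v ∘ suc
    w = v′ ⋆ B′
    ω₀ = λ K → ω (false ∷ K)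
    ω₁ = λ K → ω (true ∷ K)
    Ω₀ = ext B′ ω₀
    Ω₁ = ext B′ ω₁
    W = (w ⋏ (b ⋏ Ω₁)) J
    L = ∘-linear (⋏-linear b) (ext-linear B′)

  -- The Cauchy–Binet formula.
  ext-⊗ : ∀ {k l m} (A : Matrix R k l) (B : Matrix R l m) ω →
          ext (_⊗_ R A B) ω ≋ ext B (ext A ω)
  ext-⊗ {zero}  A B ω J = sym (trans (T-⊡ (ext-linear B) _ one J) (*-congˡ (one-row B J)))
  ext-⊗ {suc k} A B ω J = begin
    ext (_⊗_ R A′ B) ω₀ J + ((A zero ⋆ B) ⋏ ext (_⊗_ R A′ B) ω₁) J
      ≈⟨ +-cong (ext-⊗ A′ B ω₀ J) (⋏-cong (λ _ → refl) (ext-⊗ A′ B ω₁) J) ⟩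
    ext B (ext A′ ω₀) J + ((A zero ⋆ B) ⋏ ext B (ext A′ ω₁)) J
      ≈⟨ +-congˡ (ext-⋏ B (A zero) _ J) ⟨
    ext B (ext A′ ω₀) J + ext B (A zero ⋏ ext A′ ω₁) J
      ≈⟨ T-⊞ (ext-linear B) _ _ J ⟨
    ext B (ext A ω) J ∎
    where
    A′ = A ∘ suc
    ω₀ = λ K → ω (false ∷ K)
    ω₁ = λ K → ω (true ∷ K)

  -- The determinant as top coefficient of the product of the rows.

  rows : ∀ {k l} → Matrix R k l → Λ l
  rows {zero}  A = one
  rows {suc k} A = A zero ⋏ rows (A ∘ suc)

  ext-full : ∀ {k l} (A : Matrix R k l) → ext A (basis full) ≋ rows A
  ext-full {zero}  A J = *-identityˡ _
  ext-full {suc k} A J = trans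
    (+-cong (T-𝟎 (ext-linear (A ∘ suc)) J) (⋏-cong (λ _ → refl) (ext-full (A ∘ suc)) J))
    (+-identityˡ _)

  -- The coefficients at index sets without j describe the quotient in which the generator eⱼ is
  -- zero; there a vector loses its j-th coordinate. This produces the minors in the definition of
  -- `det`.
  ⋏-delete : ∀ {n} (j : Fin (suc n)) (v : Vector (suc n)) ω K →
             (v ⋏ ω) (insertAt K j false) ≈ ((v ∘ punchIn j) ⋏ (λ L → ω (insertAt L j false))) K
  ⋏-delete zero    v ω K           = refl
  ⋏-delete (suc j) v ω (false ∷ K) = ⋏-delete j (v ∘ suc) _ K
  ⋏-delete (suc j) v ω (true ∷ K)  = +-congˡ (*-congˡ (⋏-delete j (v ∘ suc) _ K))

  one-delete : ∀ {n} (j : Fin (suc n)) K → one (insertAt K j false) ≡ one K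
  one-delete zero    K           = ≡.refl
  one-delete (suc j) (false ∷ K) = one-delete j K
  one-delete (suc j) (true ∷ K)  = ≡.refl

  rows-delete : ∀ {k n} (j : Fin (suc n)) (A : Matrix R k (suc n)) K →
                rows A (insertAt K j false) ≈ rows (λ r s → A r (punchIn j s)) K
  rows-delete {zero}  j A K = reflexive (one-delete j K)
  rows-delete {suc k} j A K = trans (⋏-delete j (A zero) _ K)
    (⋏-cong (λ _ → refl) (rows-delete j (A ∘ suc)) K)

  -- To reach its place in the top monomial, eⱼ passes all smaller generators; each passage gives a
  -- factor -1, and `altSign` collects them.
  ⋏-top : ∀ {n} (v : Vector (suc n)) ω →
          (v ⋏ ω) full ≈ sumFin R (suc n) (λ j → altSign R j * (v j * ω (insertAt full j false)))
  ⋏-top {zero} v ω = +-cong (sym (*-identityˡ _)) (zeroʳ _)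
  ⋏-top {suc n} v ω = +-cong (sym (*-identityˡ _))
    (trans (*-congˡ (⋏-top (v ∘ suc) (λ L → ω (true ∷ L)))) (trans (*-sumFin (suc n) _ term)
      (sumFin-cong (suc n) (λ j → trans
        (sym (*-assoc _ (altSign R j) (v (suc j) * ω (true ∷ insertAt full j false))))
        (*-congʳ (-1*x≈-x (altSign R j)))))))
    where
    term : Vector (suc n)
    term j = altSign R j * (v (suc j) * ω (true ∷ insertAt full j false))

  -- `⋏-top` is the expansion along the first row, and `rows-delete` identifies the cofactors.
  det-rows : ∀ n (A : Matrix R n n) → det R n A ≈ rows A full
  det-rows zero    A = refl
  det-rows (suc n) A = sym (trans (⋏-top (A zero) (rows (A ∘ suc)))
    (sumFin-cong (suc n) (λ j → *-congˡ {altSign R j} (*-congˡ {A zero j}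
      (trans (rows-delete j (A ∘ suc) full) (sym (det-rows n _)))))))

  -- The determinant of yI + A as a weighted trace.

  -- The rows of `identity`, given by recursion on the indices so that they compute under `suc`.
  unit : ∀ {n} → Fin n → Vector n
  unit zero    zero    = 1#
  unit zero    (suc q) = 0#
  unit (suc p) zero    = 0#
  unit (suc p) (suc q) = unit p q

  unit-zero-⋏ : ∀ {n} (ω : Λ (suc n)) K → (unit zero ⋏ ω) (true ∷ K) ≈ ω (false ∷ K)
  unit-zero-⋏ ω K = trans
    (+-cong (*-identityˡ _) (trans (*-congˡ (⋏-zeroˡ (λ _ → refl) _ K)) (zeroʳ _)))
    (+-identityʳ _)

  unit-suc-⋏ : ∀ {n} (p : Fin n) (ω : Λ (suc n)) K →
               (unit (suc p) ⋏ ω) (true ∷ K) ≈ - 1# * (unit p ⋏ (λ L → ω (true ∷ L))) K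
  unit-suc-⋏ p ω K = trans (+-congʳ (zeroˡ _)) (+-identityˡ _)

  -- The first row y e₁ + a₁ is split; in the term with a₁ the wedge product with a₁ is
  -- absorbed into f.  Passing to the coefficient of the first generator then
  -- compensates the sign of moving a₁ past the e's, so that f keeps its hypothesis.
  rows-shifted : ∀ {n N} y (E A : Matrix R n N) {f : Λ N → Λ n} → Linear f →
                 (∀ p ω → f (E p ⋏ ω) ≋ unit p ⋏ f ω) →
                 f (rows (λ p q → y * E p q + A p q)) full ≈
                 sumVec n (λ K → pow R y (zeros K) * f (ext A (basis K)) K)
  rows-shifted {zero} y E A L comm =
    trans (T-cong L (λ _ → sym (*-identityˡ _)) []) (sym (*-identityˡ _))
  rows-shifted {suc n} y E A {f} L comm = begin
    f ((λ q → y * E zero q + A zero q) ⋏ ρ) full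
      ≈⟨ T-cong L (λ K → trans (⋏-addˡ _ (A zero) ρ K) (+-congʳ (⋏-scaleˡ y (E zero) ρ K))) full ⟩
    f (y ⊡ E zero ⋏ ρ ⊞ A zero ⋏ ρ) full
      ≈⟨ trans (T-⊞ L _ _ full) (+-congʳ (T-⊡ L _ _ full)) ⟩
    y * f (E zero ⋏ ρ) full + f (A zero ⋏ ρ) full
      ≈⟨ +-congʳ (*-congˡ (trans (comm zero ρ full) (unit-zero-⋏ (f ρ) full))) ⟩
    y * f ρ (false ∷ full) + f (A zero ⋏ ρ) full
      ≈⟨ +-cong
           (*-congˡ (rows-shifted y E′ A′ (∘-linear (restrict-linear false) L)
             (λ p ω K → comm (suc p) ω (false ∷ K))))
           (rows-shifted y E′ A′
             (∘-linear (restrict-linear true) (∘-linear L (⋏-linear (A zero)))) absorbed) ⟩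
    y * sumVec n (λ K → pow R y (zeros K) * f (ext A′ (basis K)) (false ∷ K)) +
    sumVec n (λ K → pow R y (zeros K) * f (A zero ⋏ ext A′ (basis K)) (true ∷ K))
      ≈⟨ +-cong
           (trans (*-sumVec n y _) (sumVec-cong n (λ K → trans (sym (*-assoc _ _ _))
             (*-congˡ (T-cong L (λ J → sym (trans
               (+-congˡ (⋏-zeroʳ (A zero) (T-𝟎 (ext-linear A′)) J)) (+-identityʳ _))) (false ∷ K))))))
           (sumVec-cong n (λ K → *-congˡ (T-cong L (λ J → sym (trans
             (+-congʳ (T-𝟎 (ext-linear A′) J)) (+-identityˡ _))) (true ∷ K)))) ⟩
    sumVec (suc n) (λ K → pow R y (zeros K) * f (ext A (basis K)) K) ∎
    where
    E′ = E ∘ suc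
    A′ = A ∘ suc
    ρ = rows (λ p q → y * E′ p q + A′ p q)
    absorbed : ∀ p ω K → f (A zero ⋏ (E′ p ⋏ ω)) (true ∷ K) ≈
                         (unit p ⋏ (λ L → f (A zero ⋏ ω) (true ∷ L))) K
    absorbed p ω K = begin
      f (A zero ⋏ (E′ p ⋏ ω)) (true ∷ K)
        ≈⟨ T-cong L (⋏-anticomm (A zero) (E′ p) ω) (true ∷ K) ⟩
      f (- 1# ⊡ E′ p ⋏ (A zero ⋏ ω)) (true ∷ K)
        ≈⟨ T-⊡ L _ _ (true ∷ K) ⟩
      - 1# * f (E′ p ⋏ (A zero ⋏ ω)) (true ∷ K)
        ≈⟨ *-congˡ (trans (comm (suc p) _ (true ∷ K)) (unit-suc-⋏ p (f (A zero ⋏ ω)) K)) ⟩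
      - 1# * (- 1# * (unit p ⋏ (λ L → f (A zero ⋏ ω) (true ∷ L))) K)
        ≈⟨ trans (sym (*-assoc _ _ _)) (trans (*-congʳ -1²) (*-identityˡ _)) ⟩
      (unit p ⋏ (λ L → f (A zero ⋏ ω) (true ∷ L))) K ∎

  identity-unit : ∀ {n} (p q : Fin n) → identity R n p q ≈ unit p q
  identity-unit zero    zero    = refl
  identity-unit zero    (suc q) = refl
  identity-unit (suc p) zero    = refl
  identity-unit {suc n} (suc p) (suc q) with p ≟ᶠ q | identity-unit p q
  ... | yes _ | ih = ih
  ... | no  _ | ih = ih

  -- The case of `rows-shifted` where `f` is the identity map and the rows of `E` are the unit
  -- vectors.
  det-shifted : ∀ n y (A : Matrix R n n) → det R n (_⊕_ R (_·ₘ_ R y (identity R n)) A) ≈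
                sumVec n (λ K → pow R y (zeros K) * ext A (basis K) K)
  det-shifted n y A = trans (det-rows n _)
    (rows-shifted y (identity R n) A id-linear (λ p ω → ⋏-cong (identity-unit p) (λ _ → refl)))

  -- Permanents, and the disappearance of signs for non-crossing edges.

  -- For ε = 1 the place of a generator does not matter, so one sums over the element `q` of `J`
  -- supplied by `v`. In `Z-rows` this is the choice of the edge at a white vertex.
  perm-⋏ : ∀ {n} (v : Vector n) ω J → (v Perm.⋏ ω) J ≈
           sumFin R n (λ q → if lookup J q then v q * ω (J [ q ]≔ false) else 0#)
  perm-⋏ v ω []          = refl
  perm-⋏ v ω (false ∷ J) = trans (perm-⋏ (v ∘ suc) (λ K → ω (false ∷ K)) J) (sym (+-identityˡ _))
  perm-⋏ v ω (true ∷ J)  =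
    +-congˡ (trans (*-identityˡ _) (perm-⋏ (v ∘ suc) (λ K → ω (true ∷ K)) J))

  -- No generator of v has to be moved past a smaller one of ω, so no sign arises.
  sorted-⋏ : ∀ {n} (v : Vector n) ω →
             (∀ q → Avoids q ω ⊎ (∀ q′ → q <ᶠ q′ → v q′ ≈ 0#)) → v Perm.⋏ ω ≋ v ⋏ ω
  sorted-⋏ v ω h []          = refl
  sorted-⋏ v ω h (false ∷ K) = sorted-⋏ (v ∘ suc) _
    (λ q → Sum.map (λ a L → a (false ∷ L)) (λ z q′ lt → z (suc q′) (s≤s lt)) (h (suc q))) K
  sorted-⋏ v ω h (true ∷ K) = +-congˡ (trans
    (vanish (Twisted.⋏-zeroʳ 1#) (Twisted.⋏-zeroˡ 1#))
    (sym (vanish (Twisted.⋏-zeroʳ (- 1#)) (Twisted.⋏-zeroˡ (- 1#)))))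
    where
    vanish : ∀ {ε} →
             (∀ {n} (v : Vector n) {ω} → ω ≋ 𝟎 → Twisted._⋏_ ε v ω ≋ 𝟎) →
             (∀ {n} {v : Vector n} → (∀ i → v i ≈ 0#) → ∀ ω → Twisted._⋏_ ε v ω ≋ 𝟎) →
             ε * Twisted._⋏_ ε (v ∘ suc) (λ L → ω (true ∷ L)) K ≈ 0#
    vanish {ε} zʳ zˡ with h zero
    ... | inj₁ a = trans (*-congˡ (zʳ (v ∘ suc) (λ L → a (true ∷ L) ≡.refl) K)) (zeroʳ ε)
    ... | inj₂ z = trans (*-congˡ (zˡ (λ q → z (suc q) (s≤s z≤n)) _ K)) (zeroʳ ε)

  -- Take a column `q`. If a later row has an edge to `q`, an edge from the first row to a column
  -- right of `q` would cross it; if none has, the product of the later rows avoids `q`. Either way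
  -- `sorted-⋏` applies.
  noncrossing-ext : ∀ {k l} (e : Fin k → Fin l → Bool) (A : Matrix R k l) → NonCrossing e →
                    (∀ p q → ¬ T (e p q) → A p q ≈ 0#) → ∀ ω → Perm.ext A ω ≋ ext A ω
  noncrossing-ext {zero}  e A nc z ω J = refl
  noncrossing-ext {suc k} e A nc z ω J = +-cong (ih _ J)
    (trans (sorted-⋏ (A zero) _ sorted J) (⋏-cong (λ _ → refl) (ih _) J))
    where
    ih = noncrossing-ext (e ∘ suc) (A ∘ suc) (λ t t′ (lt , lt′) → nc t t′ (s≤s lt , lt′)) (z ∘ suc)
    sorted : ∀ q → Avoids q (Perm.ext (A ∘ suc) _) ⊎ (∀ q′ → q <ᶠ q′ → A zero q′ ≈ 0#)
    sorted q with any? (λ p → T? (e (suc p) q))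
    ... | yes (p , t) = inj₂ (λ q′ lt → z zero q′ (λ t′ → nc t′ t (s≤s z≤n , lt)))
    ... | no ¬t       = inj₁ (Perm.ext-avoids (λ p → z (suc p) q (λ t → ¬t (p , t))) _)

-- Sets of vertices and the deletion of vertices.

∧-interchange : ∀ p q r s → (p ∧ q) ∧ (r ∧ s) ≡ (p ∧ r) ∧ (q ∧ s)
∧-interchange false q     r     s = ≡.refl
∧-interchange true  false false s = ≡.refl
∧-interchange true  false true  s = ≡.refl
∧-interchange true  true  r     s = ≡.refl

module _ {V : Set} (_≟_ : DecidableEquality V) where

  delete : (V → Bool) → V → V → Bool
  delete σ w v = if does (w ≟ v) then false else σ v

  delete-cong : ∀ {σ σ′} w → σ ≗ σ′ → delete σ w ≗ delete σ′ w
  delete-cong w p v with does (w ≟ v)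
  ... | true  = ≡.refl
  ... | false = p v

  delete-comm : ∀ σ w w′ → delete (delete σ w) w′ ≗ delete (delete σ w′) w
  delete-comm σ w w′ v with does (w ≟ v) | does (w′ ≟ v)
  ... | true  | true  = ≡.refl
  ... | true  | false = ≡.refl
  ... | false | true  = ≡.refl
  ... | false | false = ≡.refl

  delete-self : ∀ σ w → delete σ w w ≡ false
  delete-self σ w with w ≟ w
  ... | yes _  = ≡.refl
  ... | no w≢w with () ← w≢w ≡.refl

  -- Two edges can be used together in either order of processing. For `w` equal to `w′` both sides
  -- are false, as a vertex is covered only once.
  delete-exchange : ∀ σ w w′ → σ w ∧ delete σ w w′ ≡ σ w′ ∧ delete σ w′ w
  delete-exchange σ w w′ with w ≟ w′ | w′ ≟ w
  ... | yes _   | yes _ = ≡.trans (∧-zeroʳ (σ w)) (≡.sym (∧-zeroʳ (σ w′)))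
  ... | no _    | no _  = ∧-comm (σ w) (σ w′)
  ... | yes ≡.refl | no ≢  with () ← ≢ ≡.refl
  ... | no ≢    | yes ≡.refl with () ← ≢ ≡.refl

  -- σ K is a set of vertices that varies with K exactly on the vertices g j.
  record Tracks {n} (g : Fin n → V) (σ : Vec Bool n → V → Bool) : Set where
    field
      at   : ∀ K j → σ K (g j) ≡ lookup K j
      drop : ∀ K j → delete (σ K) (g j) ≗ σ (K [ j ]≔ false)

  tracks-tail : ∀ {n} {g : Fin (suc n) → V} {σ} → Tracks g σ →
                ∀ b → Tracks (g ∘ suc) (λ K → σ (b ∷ K))
  tracks-tail t b = record { at = λ K j → at (b ∷ K) (suc j) ; drop = λ K j → drop (b ∷ K) (suc j) }
    where open Tracks t

module _ {V₁ V₂ : Set} (_≟₁_ : DecidableEquality V₁) (_≟₂_ : DecidableEquality V₂) where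

  tracks-inj₁ : ∀ {n} {g : Fin n → V₁} {σ} → Tracks _≟₁_ g σ → ∀ ρ →
                Tracks (≡-dec _≟₁_ _≟₂_) (inj₁ ∘ g) (λ K → [ σ K , ρ ]′)
  tracks-inj₁ t ρ = record
    { at = Tracks.at t ; drop = λ { K j (inj₁ v) → Tracks.drop t K j v ; K j (inj₂ v) → ≡.refl } }

  tracks-inj₂ : ∀ {n} {g : Fin n → V₂} {σ} → Tracks _≟₂_ g σ → ∀ ρ →
                Tracks (≡-dec _≟₁_ _≟₂_) (inj₂ ∘ g) (λ K → [ ρ , σ K ]′)
  tracks-inj₂ t ρ = record
    { at = Tracks.at t ; drop = λ { K j (inj₁ v) → ≡.refl ; K j (inj₂ v) → Tracks.drop t K j v } }

lookup-tracks : ∀ {n} → Tracks (_≟ᶠ_ {n}) id lookup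
lookup-tracks = record { at = λ K j → ≡.refl ; drop = drop }
  where
  drop : ∀ {n} (K : Vec Bool n) j → delete _≟ᶠ_ (lookup K) j ≗ lookup (K [ j ]≔ false)
  drop (b ∷ K) zero    zero    = ≡.refl
  drop (b ∷ K) zero    (suc i) = ≡.refl
  drop (b ∷ K) (suc j) zero    = ≡.refl
  drop (b ∷ K) (suc j) (suc i) = drop K j i

none : ∀ {V : Set} → List V → (V → Bool) → Bool
none vs σ = and (map (not ∘ σ) vs)

none-cong : ∀ {V : Set} (vs : List V) {σ σ′ : V → Bool} → σ ≗ σ′ → none vs σ ≡ none vs σ′
none-cong vs p = ≡.cong and (map-cong (λ v → ≡.cong not (p v)) vs)

and-false : ∀ {V : Set} {vs : List V} {v} (f : V → Bool) → v ∈ vs →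
            f v ≡ false → and (map f vs) ≡ false
and-false f (here ≡.refl) p rewrite p = ≡.refl
and-false {vs = w ∷ vs} f (there v∈vs) p =
  ≡.trans (≡.cong (f w ∧_) (and-false f v∈vs p)) (∧-zeroʳ (f w))

none-⊎ : ∀ {V₁ V₂ : Set} (vs₁ : List V₁) (vs₂ : List V₂) (σ : V₁ ⊎ V₂ → Bool) →
         none (map inj₁ vs₁ ++ map inj₂ vs₂) σ ≡ none vs₁ (σ ∘ inj₁) ∧ none vs₂ (σ ∘ inj₂)
none-⊎ []         vs₂ σ = ≡.cong and (≡.sym (map-∘ vs₂))
none-⊎ (v ∷ vs₁) vs₂ σ =
  ≡.trans (≡.cong (not (σ (inj₁ v)) ∧_) (none-⊎ vs₁ vs₂ σ)) (≡.sym (∧-assoc (not (σ (inj₁ v))) _ _))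

-- Exponents with truncated subtraction.

zeros+ones : ∀ {n} (K : Vec Bool n) → zeros K +ℕ ones K ≡ n
zeros+ones []          = ≡.refl
zeros+ones (false ∷ K) = ≡.cong suc (zeros+ones K)
zeros+ones (true ∷ K)  = ≡.trans (ℕ.+-suc (zeros K) (ones K)) (≡.cong suc (zeros+ones K))

ones≤n : ∀ {n} (K : Vec Bool n) → ones K ≤ n
ones≤n K = ≡.subst (ones K ≤_) (zeros+ones K) (ℕ.m≤n+m (ones K) (zeros K))

∸-ones : ∀ {n} (K : Vec Bool n) → n ∸ ones K ≡ zeros K
∸-ones K = ≡.trans (≡.cong (_∸ ones K) (≡.sym (zeros+ones K))) (ℕ.m+n∸n≡m (zeros K) (ones K))

∸-+-comm : ∀ m n → m ∸ n +ℕ n ≡ n ∸ m +ℕ m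
∸-+-comm zero    zero    = ≡.refl
∸-+-comm zero    (suc n) = ≡.sym (ℕ.+-identityʳ (suc n))
∸-+-comm (suc m) zero    = ℕ.+-identityʳ (suc m)
∸-+-comm (suc m) (suc n) = ≡.trans (ℕ.+-suc (m ∸ n) n)
  (≡.trans (≡.cong suc (∸-+-comm m n)) (≡.sym (ℕ.+-suc (n ∸ m) m)))

-- Put l = z + d. As (b ∸ l) - (l ∸ b) = b - l, the claim is b - l + z = b - d with the possibly
-- negative part moved across. In its use l counts generators, d is the degree and z the size of the
-- complement.
exponents : ∀ d b z → d ≤ b → b ∸ (z +ℕ d) +ℕ z ≡ (z +ℕ d) ∸ b +ℕ (b ∸ d)
exponents zero    b       z le       rewrite ℕ.+-identityʳ z = ∸-+-comm b z
exponents (suc d) (suc b) z (s≤s le) rewrite ℕ.+-suc z d = exponents d b z le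

-- Sums over matchings that cover prescribed vertices.

module Matchings {c ℓ : Level} (R : CommutativeRing c ℓ) where
  open CommutativeRing R hiding (zero)
  open Exterior R
  open import Relation.Binary.Reasoning.Setoid setoid
  open import Algebra.Solver.Ring.NaturalCoefficients.Default commutativeSemiring

  Edge : Set → Set → Set c
  Edge W B = W × B × Carrier

  ind : Bool → Carrier
  ind b = if b then 1# else 0#

  ind-∧ : ∀ a b → ind (a ∧ b) ≈ ind a * ind b
  ind-∧ true  b = sym (*-identityˡ _)
  ind-∧ false b = sym (zeroˡ _)

  infixr 5 _⇒_
  _⇒_ : Bool → Carrier → Carrier
  b ⇒ x = if b then x else 0#

  ⇒-cong : ∀ {a b x y} → a ≡ b → x ≈ y → a ⇒ x ≈ b ⇒ y
  ⇒-cong {true}  ≡.refl p = p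
  ⇒-cong {false} ≡.refl p = refl

  ⇒-zero : ∀ {x} b → x ≈ 0# → b ⇒ x ≈ 0#
  ⇒-zero true  p = p
  ⇒-zero false p = refl

  *-⇒ : ∀ x b y → x * (b ⇒ y) ≈ (b ⇒ x * y)
  *-⇒ x true  y = refl
  *-⇒ x false y = zeroʳ x

  ⇒-* : ∀ b x y → (b ⇒ x) * y ≈ (b ⇒ x * y)
  ⇒-* true  x y = refl
  ⇒-* false x y = zeroˡ y

  ⇒-nest : ∀ a b x y z → a ⇒ (x * (y + (b ⇒ z))) ≈ (a ⇒ (x * y)) + ((a ∧ b) ⇒ (x * z))
  ⇒-nest true  true  x y z = distribˡ x y z
  ⇒-nest true  false x y z = trans (*-congˡ (+-identityʳ y)) (sym (+-identityʳ _))
  ⇒-nest false b     x y z = sym (+-identityˡ 0#)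

  module Graph {W B : Set} (_≟W_ : DecidableEquality W) (_≟B_ : DecidableEquality B)
               (ws : List W) (bs : List B) where

    -- The sum over the matchings that cover exactly the vertices in σ and τ.
    Z : List (Edge W B) → (W → Bool) → (B → Bool) → Carrier
    Z []                σ τ = ind (none ws σ) * ind (none bs τ)
    Z ((w , b , x) ∷ E) σ τ =
      Z E σ τ + ((σ w ∧ τ b) ⇒ (x * Z E (delete _≟W_ σ w) (delete _≟B_ τ b)))

    Z-cong : ∀ E {σ σ′ τ τ′} → σ ≗ σ′ → τ ≗ τ′ → Z E σ τ ≈ Z E σ′ τ′
    Z-cong []                p q = reflexive
      (≡.cong₂ (λ a b → ind a * ind b) (none-cong ws p) (none-cong bs q))
    Z-cong ((w , b , x) ∷ E) p q = +-cong (Z-cong E p q)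
      (⇒-cong (≡.cong₂ _∧_ (p w) (q b))
        (*-congˡ (Z-cong E (delete-cong _≟W_ w p) (delete-cong _≟B_ b q))))

    -- Unfolding twice gives four terms: neither edge used, just one of them, or both. Only the last
    -- depends on the order of deletion, and `delete-comm` and `delete-exchange` make it symmetric.
    Z-swap : ∀ e e′ E σ τ → Z (e ∷ e′ ∷ E) σ τ ≈ Z (e′ ∷ e ∷ E) σ τ
    Z-swap e@(w , b , x) e′@(w′ , b′ , x′) E σ τ = begin
      Z E σ τ + single e′ + (σ w ∧ τ b ⇒ x * (Z E (σ₁ w) (τ₁ b) + _))
        ≈⟨ +-congˡ (⇒-nest (σ w ∧ τ b) _ x _ _) ⟩
      Z E σ τ + single e′ + (single e + double e e′)
        ≈⟨ solve 4 (λ z a a′ d → z :+ a′ :+ (a :+ d) := z :+ a :+ (a′ :+ d)) refl _ _ _ _ ⟩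
      Z E σ τ + single e + (single e′ + double e e′)
        ≈⟨ +-congˡ (+-congˡ (⇒-cong used
             (trans (trans (sym (*-assoc _ _ _)) (*-congʳ (*-comm x x′))) (trans (*-assoc _ _ _)
               (*-congˡ (*-congˡ (Z-cong E
                 (delete-comm _≟W_ σ w w′) (delete-comm _≟B_ τ b b′)))))))) ⟩
      Z E σ τ + single e + (single e′ + double e′ e)
        ≈⟨ +-congˡ (⇒-nest (σ w′ ∧ τ b′) _ x′ _ _) ⟨
      Z E σ τ + single e + (σ w′ ∧ τ b′ ⇒ x′ * (Z E (σ₁ w′) (τ₁ b′) + _)) ∎
      where
      σ₁ = delete _≟W_ σ
      τ₁ = delete _≟B_ τ
      single : Edge W B → Carrier
      single (w , b , x) = σ w ∧ τ b ⇒ x * Z E (σ₁ w) (τ₁ b)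
      both : Edge W B → Edge W B → Bool
      both (w , b , x) (w′ , b′ , x′) = (σ w ∧ τ b) ∧ (σ₁ w w′ ∧ τ₁ b b′)
      double : Edge W B → Edge W B → Carrier
      double e@(w , b , x) e′@(w′ , b′ , x′) =
        both e e′ ⇒ x * (x′ * Z E (delete _≟W_ (σ₁ w) w′) (delete _≟B_ (τ₁ b) b′))
      used : both e e′ ≡ both e′ e
      used = ≡.trans (∧-interchange (σ w) _ _ _) (≡.trans
        (≡.cong₂ _∧_ (delete-exchange _≟W_ σ w w′) (delete-exchange _≟B_ τ b b′))
        (≡.sym (∧-interchange (σ w′) _ _ _)))

    Z-∷ : ∀ e E E′ → (∀ σ τ → Z E σ τ ≈ Z E′ σ τ) → ∀ σ τ → Z (e ∷ E) σ τ ≈ Z (e ∷ E′) σ τ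
    Z-∷ (w , b , x) E E′ p σ τ = +-cong (p σ τ) (⇒-cong {σ w ∧ τ b} ≡.refl (*-congˡ (p _ _)))

    Z-↭ : ∀ {E E′} → E ↭ E′ → ∀ σ τ → Z E σ τ ≈ Z E′ σ τ
    Z-↭ ↭.refl σ τ = refl
    Z-↭ (↭.prep {E} {E′} e p) σ τ = Z-∷ e E E′ (Z-↭ p) σ τ
    Z-↭ (↭.swap {E} {E′} e e′ p) σ τ = trans (Z-swap e e′ E σ τ)
      (Z-∷ e′ (e ∷ E) (e ∷ E′) (Z-∷ e E E′ (Z-↭ p)) σ τ)
    Z-↭ (↭.trans p q) σ τ = trans (Z-↭ p σ τ) (Z-↭ q σ τ)

    Z-parallel : ∀ {m n} (β : Fin m → W) (γ : Fin m → B) (h : Fin n → Fin m) {σ τ} →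
                 Tracks _≟W_ (β ∘ h) σ → Tracks _≟B_ (γ ∘ h) τ → ∀ x E →
                 Z (map (λ j → β j , γ j , x) (tabulate h) ++ E) (σ full) (τ full) ≈
                 sumVec n (λ K → pow R x (zeros K) * Z E (σ K) (τ K))
    Z-parallel {n = zero}  β γ h tσ tτ x E = sym (*-identityˡ _)
    Z-parallel {n = suc n} β γ h {σ} {τ} tσ tτ x E = trans (+-comm _ _) (+-cong
      (trans
        (⇒-cong (≡.cong₂ _∧_ (Tracks.at tσ full zero) (Tracks.at tτ full zero))
          (*-congˡ (trans
            (Z-cong (map _ (tabulate (h ∘ suc)) ++ E)
              (Tracks.drop tσ full zero) (Tracks.drop tτ full zero))
            (ih false))))
        (trans (*-sumVec n x _) (sumVec-cong n (λ K → sym (*-assoc _ _ _)))))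
      (ih true))
      where
      ih : ∀ b → Z (map (λ j → β j , γ j , x) (tabulate (h ∘ suc)) ++ E)
                   (σ (b ∷ full)) (τ (b ∷ full)) ≈
                 sumVec n (λ K → pow R x (zeros K) * Z E (σ (b ∷ K)) (τ (b ∷ K)))
      ih b = Z-parallel β γ (h ∘ suc) (tracks-tail _≟W_ tσ b) (tracks-tail _≟B_ tτ b) x E

    degree : {V : Set} → DecidableEquality V → (Edge W B → V) → List (Edge W B) → V → ℕ
    degree _≟_ f L v = length (filter (λ e → f e ≟ v) L)

    -- For σ constantly true this is the degree test in `M`; a general σ makes the test stable under
    -- removing an edge together with its ends.
    covers : {V : Set} → DecidableEquality V → (Edge W B → V) → List V →
             (V → Bool) → List (Edge W B) → Bool
    covers _≟_ f vs σ L = and (map (λ v → degree _≟_ f L v ≡ᵇ (if σ v then 1 else 0)) vs)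

    covers-[] : ∀ {V : Set} (_≟_ : DecidableEquality V) f vs σ → covers _≟_ f vs σ [] ≡ none vs σ
    covers-[] _≟_ f vs σ = ≡.cong and (map-cong pointwise vs)
      where
      pointwise : ∀ v → (0 ≡ᵇ (if σ v then 1 else 0)) ≡ not (σ v)
      pointwise v with σ v
      ... | true  = ≡.refl
      ... | false = ≡.refl

    -- If the end of `e` is outside σ, its degree is positive where 0 is prescribed, and the test
    -- fails at that element of `vs`. Otherwise deleting the end lowers the prescribed and the
    -- actual degree by one.
    covers-∷ : ∀ {V : Set} (_≟_ : DecidableEquality V) f {vs} σ e L → f e ∈ vs →
               covers _≟_ f vs σ (e ∷ L) ≡ σ (f e) ∧ covers _≟_ f vs (delete _≟_ σ (f e)) L
    covers-∷ _≟_ f {vs} σ e L e∈vs with σ (f e) in σe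
    ... | false = and-false _ e∈vs uncovered
      where
      uncovered : (degree _≟_ f (e ∷ L) (f e) ≡ᵇ (if σ (f e) then 1 else 0)) ≡ false
      uncovered rewrite σe with f e ≟ f e
      ... | yes _ = ≡.refl
      ... | no ≢  with () ← ≢ ≡.refl
    ... | true  = ≡.cong and (map-cong pointwise vs)
      where
      pointwise : ∀ v → (degree _≟_ f (e ∷ L) v ≡ᵇ (if σ v then 1 else 0)) ≡
                        (degree _≟_ f L v ≡ᵇ (if delete _≟_ σ (f e) v then 1 else 0))
      pointwise v with f e ≟ v
      ... | yes ≡.refl rewrite σe = ≡.refl
      ... | no _ = ≡.refl

    weight : List (Edge W B) → Carrier
    weight L = prodL R (map (λ e → proj₂ (proj₂ e)) L)

    term : (W → Bool) → (B → Bool) → List (Edge W B) → Carrier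
    term σ τ L = (covers _≟W_ proj₁ ws σ L ∧ covers _≟B_ (λ e → proj₁ (proj₂ e)) bs τ L) ⇒ weight L

    sumL-++ : ∀ xs ys → sumL R (xs ++ ys) ≈ sumL R xs + sumL R ys
    sumL-++ []       ys = sym (+-identityˡ _)
    sumL-++ (x ∷ xs) ys = trans (+-congˡ (sumL-++ xs ys)) (sym (+-assoc _ _ _))

    sumL-⇒ : ∀ {A : Set c} b x {f g : A → Carrier} → (∀ a → f a ≈ (b ⇒ x * g a)) → ∀ as →
             sumL R (map f as) ≈ (b ⇒ x * sumL R (map g as))
    sumL-⇒ true  x p []       = sym (zeroʳ x)
    sumL-⇒ true  x p (a ∷ as) = trans (+-cong (p a) (sumL-⇒ true x p as)) (sym (distribˡ _ _ _))
    sumL-⇒ false x p []       = refl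
    sumL-⇒ false x {g = g} p (a ∷ as) =
      trans (+-cong (p a) (sumL-⇒ false x {g = g} p as)) (+-identityˡ 0#)

    -- The sublists without and with the first edge give the two summands in the recursion of `Z`.
    sum-sublists : (∀ w → w ∈ ws) → (∀ b → b ∈ bs) → ∀ E σ τ →
                   sumL R (map (term σ τ) (sublists R E)) ≈ Z E σ τ
    sum-sublists ∈ws ∈bs [] σ τ = trans (+-identityʳ _) (trans
      (reflexive (≡.cong₂ (λ a b → ind (a ∧ b)) (covers-[] _≟W_ proj₁ ws σ)
                                               (covers-[] _≟B_ (λ e → proj₁ (proj₂ e)) bs τ)))
      (ind-∧ _ _))
    sum-sublists ∈ws ∈bs (e@(w , b , x) ∷ E) σ τ = begin
      sumL R (map (term σ τ) (sublists R E ++ map (e ∷_) (sublists R E)))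
        ≡⟨ ≡.cong (sumL R) (map-++ (term σ τ) (sublists R E) _) ⟩
      sumL R (map (term σ τ) (sublists R E) ++ map (term σ τ) (map (e ∷_) (sublists R E)))
        ≈⟨ sumL-++ (map (term σ τ) (sublists R E)) _ ⟩
      sumL R (map (term σ τ) (sublists R E)) + sumL R (map (term σ τ) (map (e ∷_) (sublists R E)))
        ≡⟨ ≡.cong (λ L → _ + sumL R L) (map-∘ (sublists R E)) ⟨
      sumL R (map (term σ τ) (sublists R E)) + sumL R (map (term σ τ ∘ (e ∷_)) (sublists R E))
        ≈⟨ +-cong (sum-sublists ∈ws ∈bs E σ τ) (trans
             (sumL-⇒ (σ w ∧ τ b) x (λ L → trans
               (⇒-cong (≡.trans
                 (≡.cong₂ _∧_ (covers-∷ _≟W_ proj₁ σ e L (∈ws w))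
                             (covers-∷ _≟B_ (λ e → proj₁ (proj₂ e)) τ e L (∈bs b)))
                 (∧-interchange (σ w) _ (τ b) _)) refl)
               (split (σ w ∧ τ b) _ x (weight L))) (sublists R E))
             (⇒-cong {σ w ∧ τ b} ≡.refl (*-congˡ (sum-sublists ∈ws ∈bs E _ _)))) ⟩
      Z (e ∷ E) σ τ ∎
      where
      split : ∀ a b x y → (a ∧ b ⇒ x * y) ≈ (a ⇒ x * (b ⇒ y))
      split true  true  x y = refl
      split true  false x y = sym (zeroʳ x)
      split false b     x y = refl

  -- Matchings of a disjoint union.

  module _ {W₁ W₂ B₁ B₂ : Set}
           (_≟W₁_ : DecidableEquality W₁) (_≟W₂_ : DecidableEquality W₂)
           (_≟B₁_ : DecidableEquality B₁) (_≟B₂_ : DecidableEquality B₂)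
           (ws₁ : List W₁) (ws₂ : List W₂) (bs₁ : List B₁) (bs₂ : List B₂) where
    private
      module G₁ = Graph _≟W₁_ _≟B₁_ ws₁ bs₁
      module G₂ = Graph _≟W₂_ _≟B₂_ ws₂ bs₂
      module G = Graph (≡-dec _≟W₁_ _≟W₂_) (≡-dec _≟B₁_ _≟B₂_)
                       (map inj₁ ws₁ ++ map inj₂ ws₂) (map inj₁ bs₁ ++ map inj₂ bs₂)

    -- An edge changes the vertex sets of its own component only, so the sum of the other component
    -- factors out at each step of the recursion.
    Z-⊎ : ∀ E₁ E₂ σ τ →
          G.Z (map (λ e → inj₁ (proj₁ e) , inj₁ (proj₁ (proj₂ e)) , proj₂ (proj₂ e)) E₁ ++
               map (λ e → inj₂ (proj₁ e) , inj₂ (proj₁ (proj₂ e)) , proj₂ (proj₂ e)) E₂) σ τ ≈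
          G₁.Z E₁ (σ ∘ inj₁) (τ ∘ inj₁) * G₂.Z E₂ (σ ∘ inj₂) (τ ∘ inj₂)
    Z-⊎ [] [] σ τ = trans
      (*-cong (trans (reflexive (≡.cong ind (none-⊎ ws₁ ws₂ σ))) (ind-∧ _ _))
              (trans (reflexive (≡.cong ind (none-⊎ bs₁ bs₂ τ))) (ind-∧ _ _)))
      (solve 4 (λ a b c d → (a :* b) :* (c :* d) := (a :* c) :* (b :* d)) refl _ _ _ _)
    Z-⊎ [] ((w , b , x) ∷ E₂) σ τ = trans
      (+-cong (Z-⊎ [] E₂ σ τ) (trans
        (⇒-cong {σ (inj₂ w) ∧ τ (inj₂ b)} ≡.refl (trans (*-congˡ (Z-⊎ [] E₂ _ _))
          (solve 3 (λ x y z → x :* (y :* z) := y :* (x :* z)) refl x _ _)))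
        (sym (*-⇒ _ (σ (inj₂ w) ∧ τ (inj₂ b)) _))))
      (sym (distribˡ _ _ _))
    Z-⊎ ((w , b , x) ∷ E₁) E₂ σ τ = trans
      (+-cong (Z-⊎ E₁ E₂ σ τ) (trans
        (⇒-cong {σ (inj₁ w) ∧ τ (inj₁ b)} ≡.refl
          (trans (*-congˡ (Z-⊎ E₁ E₂ _ _)) (sym (*-assoc _ _ _))))
        (sym (⇒-* (σ (inj₁ w) ∧ τ (inj₁ b)) _ _))))
      (sym (distribʳ _ _ _))

  -- Matchings of one strand as permanents.

  none-allFin : ∀ {n} (J : Vec Bool n) → ind (none (allFin n) (lookup J)) ≈ one J
  none-allFin []          = refl
  none-allFin (true ∷ J)  = refl
  none-allFin {suc n} (false ∷ J) = trans
    (reflexive (≡.cong (ind ∘ and) (≡.trans (map-tabulate suc (not ∘ lookup (false ∷ J)))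
                                            (≡.sym (map-tabulate id (not ∘ lookup J))))))
    (none-allFin J)

  module _ {W : Set} {l : ℕ} (_≟W_ : DecidableEquality W) (ws : List W)
           (e : W → Fin l → Bool) (wt : W → Fin l → Carrier) where
    open Graph _≟W_ _≟ᶠ_ ws (allFin l)

    private
      A : W → Vector l
      A p q = if e p q then wt p q else 0#

      cell : W → Fin l → List (Edge W (Fin l))
      cell p q = if e p q then (p , q , wt p q) ∷ [] else []

    -- All these edges share the white vertex `p`. Once one of them is used, `p` is deleted and the
    -- guards of the others fail, so at most one is chosen.
    Z-row : ∀ {n} p (h : Fin n → Fin l) E σ τ →
            Z (concatMap (cell p) (tabulate h) ++ E) σ τ ≈
            Z E σ τ + sumFin R n (λ i → (σ p ∧ τ (h i)) ⇒
              A p (h i) * Z E (delete _≟W_ σ p) (delete _≟ᶠ_ τ (h i)))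
    Z-row {zero}  p h E σ τ = sym (+-identityʳ _)
    Z-row {suc n} p h E σ τ with e p (h zero)
    ... | false = trans (Z-row p (h ∘ suc) E σ τ)
      (+-congˡ (sym (trans (+-congʳ (⇒-zero (σ p ∧ τ (h zero)) (zeroˡ _))) (+-identityˡ _))))
    ... | true  = trans
      (+-cong (Z-row p (h ∘ suc) E σ τ)
        (⇒-cong {σ p ∧ τ (h zero)} ≡.refl (*-congˡ (trans (Z-row p (h ∘ suc) E _ _)
          (trans (+-congˡ (sumFin-zero n _ (λ i →
            ⇒-cong (≡.cong (_∧ delete _≟ᶠ_ τ (h zero) (h (suc i))) (delete-self _≟W_ σ p)) refl)))
            (+-identityʳ _))))))
      (solve 3 (λ z s a → z :+ s :+ a := z :+ (a :+ s)) refl _ _ _)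

    -- Rows in `I` use exactly one edge, the other rows none. The indicator factor accounts for the
    -- white vertices outside the range of `g`: no edge listed here reaches them, so none of them
    -- may be left to cover.
    Z-rows : ∀ {k} (g : Fin k → W) {σ} → (∀ i → g i ∈ ws) → Tracks _≟W_ g σ → ∀ I J →
             Z (concatMap (λ p → concatMap (cell p) (allFin l)) (tabulate g)) (σ I) (lookup J) ≈
             ind (none ws (σ (replicate k false))) * Perm.ext (A ∘ g) (basis I) J
    Z-rows {zero} g g∈ws t [] J = *-congˡ (trans (none-allFin J) (sym (*-identityˡ _)))
    Z-rows {suc k} g {σ} g∈ws t (false ∷ I) J = begin
      Z (concatMap (cell (g zero)) (allFin l) ++ rest) (σ (false ∷ I)) (lookup J)
        ≈⟨ Z-row (g zero) id rest _ _ ⟩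
      Z rest (σ (false ∷ I)) (lookup J) + _
        ≈⟨ +-cong (Z-rows (g ∘ suc) (g∈ws ∘ suc) (tracks-tail _≟W_ t false) I J)
             (sumFin-zero l _ (λ q →
               ⇒-cong (≡.cong (_∧ lookup J q) (Tracks.at t (false ∷ I) zero)) refl)) ⟩
      C * Perm.ext A′ (basis I) J + 0#
        ≈⟨ trans (+-identityʳ _) (*-congˡ (sym (+-identityʳ _))) ⟩
      C * (Perm.ext A′ (basis I) J + 0#)
        ≈⟨ *-congˡ (+-congˡ (Perm.⋏-zeroʳ (A (g zero)) (T-𝟎 (Perm.ext-linear A′)) J)) ⟨
      C * Perm.ext (A ∘ g) (basis (false ∷ I)) J ∎
      where
      A′ = A ∘ g ∘ suc
      C = ind (none ws (σ (replicate (suc k) false)))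
      rest = concatMap (λ p → concatMap (cell p) (allFin l)) (tabulate (g ∘ suc))
    Z-rows {suc k} g {σ} g∈ws t (true ∷ I) J = begin
      Z (concatMap (cell (g zero)) (allFin l) ++ rest) (σ (true ∷ I)) (lookup J)
        ≈⟨ Z-row (g zero) id rest _ _ ⟩
      Z rest (σ (true ∷ I)) (lookup J) + _
        ≈⟨ +-cong
             -- If the row uses no edge, `g zero` stays uncovered, and the indicator from the
             -- induction hypothesis is zero.
             (trans (Z-rows (g ∘ suc) (g∈ws ∘ suc) (tracks-tail _≟W_ t true) I J)
               (trans (*-congʳ (reflexive (≡.cong ind uncovered))) (zeroˡ _)))
             (sumFin-cong l (λ q → trans
               (⇒-cong (≡.cong (_∧ lookup J q) (Tracks.at t (true ∷ I) zero))
                 (trans (*-congˡ (trans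
                   (Z-cong rest (Tracks.drop t (true ∷ I) zero) (Tracks.drop lookup-tracks J q))
                   (Z-rows (g ∘ suc) (g∈ws ∘ suc) (tracks-tail _≟W_ t false) I (J [ q ]≔ false))))
                   (solve 3 (λ a c x → a :* (c :* x) := c :* (a :* x)) refl (A (g zero) q) _ _)))
               (sym (*-⇒ C (lookup J q) _)))) ⟩
      0# + sumFin R l (λ q →
             C * (lookup J q ⇒ A (g zero) q * Perm.ext A′ (basis I) (J [ q ]≔ false)))
        ≈⟨ +-congˡ (trans (sym (*-sumFin l C _)) (*-congˡ (sym (perm-⋏ (A (g zero)) _ J)))) ⟩
      0# + C * (A (g zero) Perm.⋏ Perm.ext A′ (basis I)) J
        ≈⟨ trans (+-identityˡ _) (*-congˡ (sym (+-identityˡ _))) ⟩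
      C * (0# + (A (g zero) Perm.⋏ Perm.ext A′ (basis I)) J)
        ≈⟨ *-congˡ (+-congʳ (T-𝟎 (Perm.ext-linear A′) J)) ⟨
      C * Perm.ext (A ∘ g) (basis (true ∷ I)) J ∎
      where
      A′ = A ∘ g ∘ suc
      C = ind (none ws (σ (replicate (suc k) false)))
      rest = concatMap (λ p → concatMap (cell p) (allFin l)) (tabulate (g ∘ suc))
      uncovered : none ws (σ (true ∷ replicate k false)) ≡ false
      uncovered = and-false _ (g∈ws zero) (≡.cong not (Tracks.at t (true ∷ replicate k false) zero))

-- Transfer maps and the powers of the vertical weights.

module Fabrics {c ℓ : Level} (R : CommutativeRing c ℓ) where
  open CommutativeRing R hiding (zero)
  open Exterior R
  open Twisted (- 1#) using (ext; ext-linear; ext-homogeneous)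
  open Matchings R
  open import Relation.Binary.Reasoning.Setoid setoid
  open import Algebra.Solver.Ring.NaturalCoefficients.Default commutativeSemiring

  pow-+ : ∀ x m n → pow R x (m +ℕ n) ≈ pow R x m * pow R x n
  pow-+ x zero    n = sym (*-identityˡ _)
  pow-+ x (suc m) n = trans (*-congˡ (pow-+ x m n)) (sym (*-assoc _ _ _))

  pow-* : ∀ x y n → pow R (x * y) n ≈ pow R x n * pow R y n
  pow-* x y zero    = sym (*-identityˡ _)
  pow-* x y (suc n) = trans (*-congˡ (pow-* x y n))
    (solve 4 (λ x y p q → (x :* y) :* (p :* q) := (x :* p) :* (y :* q)) refl _ _ _ _)

  pow-cong : ∀ {x y} n → x ≈ y → pow R x n ≈ pow R y n
  pow-cong zero    p = refl
  pow-cong (suc n) p = *-cong p (pow-cong n p)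

  pow-one : ∀ n → pow R 1# n ≈ 1#
  pow-one zero    = refl
  pow-one (suc n) = trans (*-identityˡ _) (pow-one n)

  scale : ∀ {n} → Carrier → Λ n → Λ n
  scale x ω K = pow R x (zeros K) * ω K

  scale-linear : ∀ {n} x → Linear (scale {n} x)
  scale-linear x = record
    { T-cong = λ p K → *-congˡ (p K)
    ; T-⊞    = λ ω η K → distribˡ _ _ _
    ; T-⊡    = λ r ω K → solve 3 (λ p r w → p :* (r :* w) := r :* (p :* w)) refl _ r (ω K) }

  -- In degree d every complement has l - d elements, so the diagonal map is the scalar x^(l - d),
  -- here compared with x^(b - d). The truncated powers on the two sides avoid negative exponents.
  scale-homogeneous : ∀ {b l d x} {ω : Λ l} → d ≤ b → Homogeneous 0 d ω →
                      pow R x (b ∸ l) ⊡ scale x ω ≋ (pow R x (l ∸ b) * pow R x (b ∸ d)) ⊡ ω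
  scale-homogeneous {b} {l} {d} {x} {ω} d≤b h K with ones K ℕ.≟ d
  ... | no ≢       = trans (*-congˡ (trans (*-congˡ (h K ≢)) (zeroʳ _)))
                           (trans (zeroʳ _) (sym (trans (*-congˡ (h K ≢)) (zeroʳ _))))
  ... | yes ≡.refl = trans (sym (*-assoc _ _ _)) (*-congʳ (begin
    pow R x (b ∸ l) * pow R x (zeros K)      ≈⟨ pow-+ x (b ∸ l) (zeros K) ⟨
    pow R x (b ∸ l +ℕ zeros K)               ≡⟨ ≡.cong (pow R x) (≡.subst
      (λ l → b ∸ l +ℕ zeros K ≡ l ∸ b +ℕ (b ∸ ones K))
      (zeros+ones K) (exponents (ones K) b (zeros K) d≤b)) ⟩
    pow R x (l ∸ b +ℕ (b ∸ ones K))          ≈⟨ pow-+ x (l ∸ b) (b ∸ ones K) ⟩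
    pow R x (l ∸ b) * pow R x (b ∸ ones K)   ∎))

  transfer : ∀ {a b} (F : Fabric R a b) → (Fin (len R F) → Carrier) → Λ a → Λ b
  transfer [ S ]   x ω = ext (biadj R S) ω
  transfer (S ▷ F) x ω = transfer F (x ∘ suc) (scale (x zero) (ext (biadj R S) ω))

  transfer-linear : ∀ {a b} (F : Fabric R a b) x → Linear (transfer F x)
  transfer-linear [ S ]   x = ext-linear (biadj R S)
  transfer-linear (S ▷ F) x = ∘-linear (transfer-linear F (x ∘ suc))
    (∘-linear (scale-linear (x zero)) (ext-linear (biadj R S)))

  transfer-one : ∀ {a b} (F : Fabric R a b) ω → transfer F (λ _ → 1#) ω ≋ ext (prodA R F) ω
  transfer-one [ S ]   ω J = refl
  transfer-one (S ▷ F) ω J = begin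
    transfer F (λ _ → 1#) (scale 1# (ext (biadj R S) ω)) J
      ≈⟨ T-cong (transfer-linear F _) (λ K → trans (*-congʳ (pow-one (zeros K))) (*-identityˡ _)) J ⟩
    transfer F (λ _ → 1#) (ext (biadj R S) ω) J
      ≈⟨ transfer-one F _ J ⟩
    ext (prodA R F) (ext (biadj R S) ω) J
      ≈⟨ ext-⊗ (biadj R S) (prodA R F) ω J ⟨
    ext (prodA R (S ▷ F)) ω J ∎

  -- Formally `excesses` divided by `deficits` is the product of the x_i^(l_i - b), so the formula
  -- can be stated without inverting any weight.
  deficits excesses : ∀ {a b} (F : Fabric R a b) → (Fin (len R F) → Carrier) → Carrier
  deficits {b = b} F x = prodFin R (len R F) (λ i → pow R (x i) (b ∸ topSize R F i))
  excesses {b = b} F x = prodFin R (len R F) (λ i → pow R (x i) (topSize R F i ∸ b))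

  -- The degree d is the same at every level, so each level yields x_i^(b - d) up to its excess and
  -- deficit, and these collect to a power of the product of all weights. The last weight enters by
  -- the extra factor on the left, which stands for the edges closing the cylinder.
  transfer-homogeneous : ∀ {a b} (F : Fabric R a b) x {d ω} → d ≤ b → Homogeneous 0 d ω → ∀ J →
    (deficits F x * pow R (x (lastIdx R F)) (b ∸ d)) * transfer F x ω J ≈
    (excesses F x * pow R (prodFin R (len R F) x) (b ∸ d)) * ext (prodA R F) ω J
  transfer-homogeneous {b = b} [ S ] x {d} d≤b h J =
    -- For a single strand both correction products have exponent `b ∸ b` and coincide.
    *-congʳ (*-congˡ (pow-cong (b ∸ d) (sym (*-identityʳ _))))
  transfer-homogeneous {b = b} (_▷_ {b = l} S F) x {d} {ω} d≤b h J = begin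
    ((p * c₁) * z) * transfer F x′ (scale x₀ ω₁) J
      ≈⟨ solve 4 (λ p c z t → ((p :* c) :* z) :* t := (c :* z) :* (p :* t)) refl p c₁ z _ ⟩
    (c₁ * z) * (p * transfer F x′ (scale x₀ ω₁) J)
      ≈⟨ *-congˡ (T-⊡ L p _ J) ⟨
    (c₁ * z) * transfer F x′ (p ⊡ scale x₀ ω₁) J
      ≈⟨ *-congˡ (T-cong L (scale-homogeneous {b} d≤b h₁) J) ⟩
    (c₁ * z) * transfer F x′ ((q * r) ⊡ ω₁) J
      ≈⟨ *-congˡ (T-⊡ L (q * r) _ J) ⟩
    (c₁ * z) * ((q * r) * transfer F x′ ω₁ J)
      ≈⟨ solve 3 (λ a b t → a :* (b :* t) := b :* (a :* t)) refl (c₁ * z) (q * r) _ ⟩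
    (q * r) * ((c₁ * z) * transfer F x′ ω₁ J)
      ≈⟨ *-congˡ (transfer-homogeneous F x′ d≤b h₁ J) ⟩
    (q * r) * ((c₂ * y) * ext (prodA R F) ω₁ J)
      ≈⟨ solve 5 (λ q r c y t → (q :* r) :* ((c :* y) :* t) := ((q :* c) :* (r :* y)) :* t)
               refl q r c₂ y _ ⟩
    ((q * c₂) * (r * y)) * ext (prodA R F) ω₁ J
      ≈⟨ *-cong (*-congˡ (pow-* x₀ _ (b ∸ d))) (ext-⊗ (biadj R S) (prodA R F) ω J) ⟨
    (excesses (S ▷ F) x * pow R (prodFin R (len R (S ▷ F)) x) (b ∸ d)) * ext (prodA R (S ▷ F)) ω J ∎
    where
    x₀ = x zero
    x′ = x ∘ suc
    ω₁ = ext (biadj R S) ω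
    h₁ = ext-homogeneous (biadj R S) h
    L  = transfer-linear F x′
    p  = pow R x₀ (b ∸ l)
    q  = pow R x₀ (l ∸ b)
    r  = pow R x₀ (b ∸ d)
    c₁ = deficits F x′
    c₂ = excesses F x′
    z  = pow R (x′ (lastIdx R F)) (b ∸ d)
    y  = pow R (prodFin R (len R F) x′) (b ∸ d)

  -- Matchings of the stacked graph.

  -- White vertices to be covered inside the stack: `K` decides on the lowest row, which outside
  -- edges may also cover, and all higher ones are required. `top` is the analogue for black
  -- vertices.
  bot : ∀ {a b} (F : Fabric R a b) → Vec Bool a → WhiteF R F → Bool
  bot [ S ]   K = lookup K
  bot (S ▷ F) K = [ lookup K , const true ]′

  top : ∀ {a b} (F : Fabric R a b) → Vec Bool b → BlackF R F → Bool
  top [ S ]   K = lookup K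
  top (S ▷ F) K = [ const true , top F K ]′

  lookup-full : ∀ {n} (i : Fin n) → lookup full i ≡ true
  lookup-full i = lookup-replicate i true

  bot-full : ∀ {a b} (F : Fabric R a b) w → bot F full w ≡ true
  bot-full [ S ]   w        = lookup-full w
  bot-full (S ▷ F) (inj₁ w) = lookup-full w
  bot-full (S ▷ F) (inj₂ w) = ≡.refl

  top-full : ∀ {a b} (F : Fabric R a b) v → top F full v ≡ true
  top-full [ S ]   v        = lookup-full v
  top-full (S ▷ F) (inj₁ v) = ≡.refl
  top-full (S ▷ F) (inj₂ v) = top-full F v

  bot-tracks : ∀ {a b} (F : Fabric R a b) → Tracks (decW R F) (bottomV R F) (bot F)
  bot-tracks [ S ]   = lookup-tracks
  bot-tracks (S ▷ F) = tracks-inj₁ _≟ᶠ_ (decW R F) lookup-tracks (const true)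

  top-tracks : ∀ {a b} (F : Fabric R a b) → Tracks (decB R F) (topV R F) (top F)
  top-tracks [ S ]   = lookup-tracks
  top-tracks (S ▷ F) = tracks-inj₂ _≟ᶠ_ (decB R F) (top-tracks F) (const true)

  ∈-whitesF : ∀ {a b} (F : Fabric R a b) w → w ∈ whitesF R F
  ∈-whitesF [ S ]   w        = ∈-allFin w
  ∈-whitesF (S ▷ F) (inj₁ w) = ∈-++⁺ˡ (∈-map⁺ inj₁ (∈-allFin w))
  ∈-whitesF (S ▷ F) (inj₂ w) = ∈-++⁺ʳ _ (∈-map⁺ inj₂ (∈-whitesF F w))

  ∈-blacksF : ∀ {a b} (F : Fabric R a b) v → v ∈ blacksF R F
  ∈-blacksF [ S ]   v        = ∈-allFin v
  ∈-blacksF (S ▷ F) (inj₁ v) = ∈-++⁺ˡ (∈-map⁺ inj₁ (∈-allFin v))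
  ∈-blacksF (S ▷ F) (inj₂ v) = ∈-++⁺ʳ _ (∈-map⁺ inj₂ (∈-blacksF F v))

  module FG {a b} (F : Fabric R a b) = Graph (decW R F) (decB R F) (whitesF R F) (blacksF R F)

  Z-strand : ∀ {k l} (S : Strand R k l) I J →
             Graph.Z _≟ᶠ_ _≟ᶠ_ (allFin k) (allFin l) (strandEdges R S) (lookup I) (lookup J) ≈
             ext (biadj R S) (basis I) J
  Z-strand {k} {l} S I J = begin
    Graph.Z _≟ᶠ_ _≟ᶠ_ (allFin k) (allFin l) (strandEdges R S) (lookup I) (lookup J)
      ≈⟨ Z-rows _≟ᶠ_ (allFin k) (edge S) (Strand.weight S) id ∈-allFin lookup-tracks I J ⟩
    ind (none (allFin k) (lookup (replicate k false))) * Perm.ext (biadj R S) (basis I) J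
      ≈⟨ *-cong (trans (none-allFin (replicate k false)) (one-empty k))
                (noncrossing-ext (edge S) (biadj R S) (nonCrossing S) absent (basis I) J) ⟩
    1# * ext (biadj R S) (basis I) J
      ≈⟨ *-identityˡ _ ⟩
    ext (biadj R S) (basis I) J ∎
    where
    open Strand using (edge; nonCrossing)
    one-empty : ∀ n → one (replicate n false) ≈ 1#
    one-empty zero    = refl
    one-empty (suc n) = one-empty n
    absent : ∀ p q → ¬ T (edge S p q) → biadj R S p q ≈ 0#
    absent p q ¬t with edge S p q
    ... | false = refl
    ... | true with () ← ¬t _

  Z-stack : ∀ {a b} (F : Fabric R a b) x I J →
            FG.Z F (stackEdges R F x) (bot F I) (top F J) ≈ transfer F x (basis I) J
  Z-stack [ S ] x I J = Z-strand S I J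
  Z-stack (_▷_ {a} {b} S F) x I J = begin
    FG.Z (S ▷ F) (E₁ ++ V ++ E₂) (bot (S ▷ F) I) (top (S ▷ F) J)
      ≈⟨ FG.Z-↭ (S ▷ F) (shifts E₁ V) _ _ ⟩
    FG.Z (S ▷ F) (V ++ E₁ ++ E₂) (bot (S ▷ F) I) (top (S ▷ F) J)
      -- Before any vertical edge is decided, all their ends are required, which is the member at
      -- `full` of the families `σ` and `τ`.
      ≈⟨ FG.Z-cong (S ▷ F) (V ++ E₁ ++ E₂)
           (λ { (inj₁ w) → ≡.refl ; (inj₂ w) → ≡.sym (bot-full F w) })
           (λ { (inj₁ v) → ≡.sym (lookup-full v) ; (inj₂ v) → ≡.refl }) ⟩
    FG.Z (S ▷ F) (V ++ E₁ ++ E₂) (σ full) (τ full)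
      ≈⟨ FG.Z-parallel (S ▷ F) (inj₂ ∘ bottomV R F) inj₁ id
           (tracks-inj₂ _≟ᶠ_ (decW R F) (bot-tracks F) (lookup I))
           (tracks-inj₁ _≟ᶠ_ (decB R F) lookup-tracks (top F J)) (x zero) (E₁ ++ E₂) ⟩
    sumVec b (λ K → pow R (x zero) (zeros K) * FG.Z (S ▷ F) (E₁ ++ E₂) (σ K) (τ K))
      ≈⟨ sumVec-cong b (λ K → trans
           (*-congˡ (trans
             (Z-⊎ _≟ᶠ_ (decW R F) _≟ᶠ_ (decB R F) (allFin a) (whitesF R F) (allFin b) (blacksF R F)
                  (strandEdges R S) (stackEdges R F (x ∘ suc)) (σ K) (τ K))
             (*-cong (Z-strand S I K) (Z-stack F (x ∘ suc) K J))))
           (sym (*-assoc _ _ _))) ⟩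
    sumVec b (λ K → scale (x zero) (ext (biadj R S) (basis I)) K * transfer F (x ∘ suc) (basis K) J)
      ≈⟨ linear-expand (transfer-linear F (x ∘ suc)) _ J ⟨
    transfer (S ▷ F) x (basis I) J ∎
    where
    E₁ E₂ V : List (Edge (WhiteF R (S ▷ F)) (BlackF R (S ▷ F)))
    E₁ = map (λ e → inj₁ (proj₁ e) , inj₁ (proj₁ (proj₂ e)) , proj₂ (proj₂ e)) (strandEdges R S)
    V  = map (λ j → inj₂ (bottomV R F j) , inj₁ j , x zero) (allFin b)
    E₂ = map (λ e → inj₂ (proj₁ e) , inj₂ (proj₁ (proj₂ e)) , proj₂ (proj₂ e))
             (stackEdges R F (x ∘ suc))
    σ : Vec Bool b → WhiteF R (S ▷ F) → Bool
    σ K = [ lookup I , bot F K ]′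
    τ : Vec Bool b → BlackF R (S ▷ F) → Bool
    τ K = [ lookup K , top F J ]′

  -- The two determinant formulas.

  M-rect : ∀ a (F : Fabric R a a) → M R (rectGraph R F) ≈ det R a (prodA R F)
  M-rect a F = begin
    M R (rectGraph R F)
      ≈⟨ FG.sum-sublists F (∈-whitesF F) (∈-blacksF F) E (const true) (const true) ⟩
    FG.Z F E (const true) (const true)
      ≈⟨ FG.Z-cong F E (bot-full F) (top-full F) ⟨
    FG.Z F E (bot F full) (top F full)
      ≈⟨ Z-stack F (λ _ → 1#) full full ⟩
    transfer F (λ _ → 1#) (basis full) full
      ≈⟨ transfer-one F (basis full) full ⟩
    ext (prodA R F) (basis full) full
      ≈⟨ ext-full (prodA R F) full ⟩
    rows (prodA R F) full
      ≈⟨ det-rows a (prodA R F) ⟨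
    det R a (prodA R F) ∎
    where E = stackEdges R F (λ _ → 1#)

  -- A closing edge covers a bottom and a top vertex of the same index, so the same `K` is left at
  -- both ends, and the sum is a trace.
  M-cyl : ∀ a (F : Fabric R a a) x → M R (cylGraph R F x) ≈
          sumVec a (λ K → pow R (x (lastIdx R F)) (zeros K) * transfer F x (basis K) K)
  M-cyl a F x = begin
    M R (cylGraph R F x)
      ≈⟨ FG.sum-sublists F (∈-whitesF F) (∈-blacksF F) (E ++ V) (const true) (const true) ⟩
    FG.Z F (E ++ V) (const true) (const true)
      ≈⟨ FG.Z-↭ F (++-comm E V) _ _ ⟩
    FG.Z F (V ++ E) (const true) (const true)
      ≈⟨ FG.Z-cong F (V ++ E) (bot-full F) (top-full F) ⟨
    FG.Z F (V ++ E) (bot F full) (top F full)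
      ≈⟨ FG.Z-parallel F (bottomV R F) (topV R F) id (bot-tracks F) (top-tracks F) _ E ⟩
    sumVec a (λ K → pow R (x (lastIdx R F)) (zeros K) * FG.Z F E (bot F K) (top F K))
      ≈⟨ sumVec-cong a (λ K → *-congˡ (Z-stack F x K K)) ⟩
    sumVec a (λ K → pow R (x (lastIdx R F)) (zeros K) * transfer F x (basis K) K) ∎
    where
    E V : List (Edge (WhiteF R F) (BlackF R F))
    E = stackEdges R F x
    V = map (λ j → bottomV R F j , topV R F j , x (lastIdx R F)) (allFin a)

  M-cyl-det : ∀ a (F : Fabric R a a) x →
    deficits F x * M R (cylGraph R F x) ≈
    excesses F x * det R a (_⊕_ R (_·ₘ_ R (prodFin R (len R F) x) (identity R a)) (prodA R F))
  M-cyl-det a F x = begin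
    deficits F x * M R (cylGraph R F x)
      ≈⟨ trans (*-congˡ (M-cyl a F x)) (*-sumVec a _ _) ⟩
    sumVec a (λ K → deficits F x * (pow R z (zeros K) * transfer F x (basis K) K))
      -- The degree `ones K` varies with the summand, so the powers are collected for each `K`
      -- separately; the correction products are independent of `K` and factor out.
      ≈⟨ sumVec-cong a (λ K → trans (sym (*-assoc _ _ _)) (trans
           (≡.subst (λ n → (deficits F x * pow R z n) * transfer F x (basis K) K ≈
                           (excesses F x * pow R y n) * ext (prodA R F) (basis K) K)
             (∸-ones K) (transfer-homogeneous F x (ones≤n K) (basis-homogeneous K) K))
           (*-assoc _ _ _))) ⟩
    sumVec a (λ K → excesses F x * (pow R y (zeros K) * ext (prodA R F) (basis K) K))
      ≈⟨ trans (*-congˡ (det-shifted a y (prodA R F))) (*-sumVec a _ _) ⟨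
    excesses F x * det R a (_⊕_ R (_·ₘ_ R y (identity R a)) (prodA R F)) ∎
    where
    y = prodFin R (len R F) x
    z = x (lastIdx R F)

theorem2p1 : ∀ {c ℓ : Level} (R : CommutativeRing c ℓ) →
    let open CommutativeRing R in
    ((a : ℕ) (F : Fabric R a a) →
    M R (rectGraph R F) ≈ det R a (prodA R F))
    ×
    ((a : ℕ) (F : Fabric R a a) (x : Fin (len R F) → Carrier) →
    prodFin R (len R F) (λ i → pow R (x i) (a ∸ topSize R F i)) * M R (cylGraph R F x)
    ≈ prodFin R (len R F) (λ i → pow R (x i) (topSize R F i ∸ a))
    * det R a (_⊕_ R (_·ₘ_ R (prodFin R (len R F) x) (identity R a)) (prodA R F)))
theorem2p1 R = Fabrics.M-rect R , Fabrics.M-cyl-det R
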